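{- Let $(G,\psi)$ be a vertex-weighted digraph on $[\ell]$ with $\psi(i)=[a_i,b_i]$ ($a_i\le b_i$ integers), and let $v\in[\ell]$. (1) Assume $v$ is a coking in $G$, and let $(G',\psi')$ be obtained from $(G,\psi)$ by the coking elimination operation with respect to $v$. If $0\in\psi(i)$ for every $i\in[\ell]$ and $[a_i,b_i-1]\subseteq\psi(v)$ for every $i\in[\ell]\setminus\{v\}$, then $\chi_{\mathcal{A}(G,\psi)}(t)=\chi_{\mathcal{A}(G',\psi')}(t)$. (2) Assume $v$ is a king in $G$, and let $(G'',\psi'')$ be obtained from $(G,\psi)$ by the king elimination operation with respect to $v$. If $0\in\psi(i)$ for every $i\in[\ell]$ and $[a_i+1,b_i]\subseteq\psi(v)$ for every $i\in[\ell]\setminus\{v\}$, then $\chi_{\mathcal{A}(G,\psi)}(t)=\chi_{\mathcal{A}(G'',\psi'')}(t)$.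
   Context: For integers $a\le b$, $[a,b]=\{n\in\mathbb{Z}: a\le n\le b\}$ (empty if $a>b$) and $[\ell]=[1,\ell]$. A vertex-weighted digraph $(G,\psi)$ on $[\ell]$ consists of a digraph $G$ with vertex set $[\ell]$ and edge set $E_G\subseteq\{(i,j): i\ne j\}$ (both $(i,j)$ and $(j,i)$ may be edges) and a map $\psi$ assigning to each $i\in[\ell]$ an integer interval $\psi(i)=[a_i,b_i]$ with $a_i\le b_i$. The $\psi$-digraphical arrangement $\mathcal{A}(G,\psi)$ in $\mathbb{R}^\ell$ consists of the hyperplanes $x_i-x_j=0$ ($1\le i<j\le\ell$), $x_i-x_j=1$ ($(i,j)\in E_G$), and $x_i=c$ ($c\in\psi(i)$, $i\in[\ell]$). A vertex $v$ is a coking (resp. king) of $G$ if $(u,v)\in E_G$ (resp. $(v,u)\in E_G$) for every $u\ne v$. The coking elimination operation w.r.t. a coking $v$ produces $(G',\psi')$ with $E_{G'}=E_G\setminus\{(i,v): i\ne v\}$, $\psi'(i)=[a_i-1,b_i]$ for $i\ne v$ and $\psi'(v)=[a_v,b_v]$. The king elimination operation w.r.t. a king $v$ produces $(G'',\psi'')$ with $E_{G''}=E_G\setminus\{(v,i): i\ne v\}$, $\psi''(i)=[a_i,b_i+1]$ for $i\ne v$ and $\psi''(v)=[a_v,b_v]$. For an arrangement $\mathcal{A}$ in $\mathbb{R}^\ell$, $L(\mathcal{A})$ is the set of nonempty intersections of subsets of $\mathcal{A}$ (including $\mathbb{R}^\ell$), ordered by reverse inclusion, with Möbius function $\mu(\mathbb{R}^\ell)=1$,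 $\mu(X)=-\sum_{Y\supsetneq X}\mu(Y)$; the characteristic polynomial is $\chi_{\mathcal{A}}(t)=\sum_{X\in L(\mathcal{A})}\mu(X)t^{\dim X}$.
   Formalization: The arrangements are taken in ℚ^ℓ instead of ℝ^ℓ; as all hyperplanes have integer equations, the intersection poset, dimensions and characteristic polynomial are the same over both fields. -}

module Defs where

open import Data.Bool using (Bool; true; false; if_then_else_; _∧_; not)
open import Data.Nat as ℕ using (ℕ; zero; suc)
open import Data.Integer as ℤ using (ℤ; +_)
open import Data.Rational as ℚ using (ℚ)
open import Data.Fin as Fin using (Fin; toℕ)
open import Data.List using (List; []; _∷_; _++_; map; concatMap; allFin; length; lookup)
open import Data.Product using (Σ; _×_; _,_)
open import Data.Unit using (⊤)
open import Relation.Nullary using (¬_; Dec; does)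
open import Relation.Binary.PropositionalEquality using (_≡_)

sumℤ : ∀ {m} → (Fin m → ℤ) → ℤ
sumℤ {zero}  f = + 0
sumℤ {suc m} f = f Fin.zero ℤ.+ sumℤ (λ k → f (Fin.suc k))

sumℚ : ∀ {m} → (Fin m → ℚ) → ℚ
sumℚ {zero}  f = ℚ.0ℚ
sumℚ {suc m} f = f Fin.zero ℚ.+ sumℚ (λ k → f (Fin.suc k))

-- Affine space, hyperplanes, arrangements.
-- All hyperplanes are defined over ℤ, so we work in ℚ^ℓ (the intersection
-- poset of an integral arrangement over ℚ is the same as over ℝ).

Point : ℕ → Set
Point ℓ = Fin ℓ → ℚ

ℤ→ℚ : ℤ → ℚ
ℤ→ℚ c = c ℚ./ 1

data Hyp (ℓ : ℕ) : Set where
  diffH  : Fin ℓ → Fin ℓ → ℤ → Hyp ℓ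
  coordH : Fin ℓ → ℤ → Hyp ℓ

_∈H_ : ∀ {ℓ} → Point ℓ → Hyp ℓ → Set
x ∈H diffH i j c = x i ℚ.- x j ≡ ℤ→ℚ c
x ∈H coordH i c  = x i ≡ ℤ→ℚ c

Arrangement : ℕ → Set
Arrangement ℓ = List (Hyp ℓ)

SubArr : ∀ {ℓ} → Arrangement ℓ → Set
SubArr A = Fin (length A) → Bool

PSet : ℕ → Set₁
PSet ℓ = Point ℓ → Set

flat : ∀ {ℓ} (A : Arrangement ℓ) → SubArr A → PSet ℓ
flat A B x = ∀ k → B k ≡ true → x ∈H lookup A k

Nonempty : ∀ {ℓ} → PSet ℓ → Set
Nonempty {ℓ} S = Σ (Point ℓ) S

IsWhole : ∀ {ℓ} → PSet ℓ → Set
IsWhole S = ∀ x → S x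

_⊆ₛ_ : ∀ {ℓ} → PSet ℓ → PSet ℓ → Set
S ⊆ₛ T = ∀ x → S x → T x

_≐_ : ∀ {ℓ} → PSet ℓ → PSet ℓ → Set
S ≐ T = (S ⊆ₛ T) × (T ⊆ₛ S)

_⊂ₛ_ : ∀ {ℓ} → PSet ℓ → PSet ℓ → Set
S ⊂ₛ T = (S ⊆ₛ T) × ¬ (T ⊆ₛ S)

AffInd : ∀ {ℓ n} → (Fin n → Point ℓ) → Set
AffInd {ℓ} {n} p =
  (c : Fin n → ℚ) → sumℚ c ≡ ℚ.0ℚ →
  (∀ i → sumℚ (λ k → c k ℚ.* p k i) ≡ ℚ.0ℚ) → ∀ k → c k ≡ ℚ.0ℚ

IsDim : ∀ {ℓ} → PSet ℓ → ℕ → Set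
IsDim {ℓ} S d =
  Σ (Fin (suc d) → Point ℓ) (λ p → (∀ k → S (p k)) × AffInd p)
  × ((p : Fin (suc (suc d)) → Point ℓ) → (∀ k → S (p k)) → ¬ AffInd p)

-- Characteristic polynomial via the intersection poset L(A) and its
-- Möbius function.  Polynomials are coefficient functions ℕ → ℤ
-- (p d = coefficient of t^d).  IsCharPoly A p says: p = χ_A, witnessed by
-- an enumeration rep : Fin m → SubArr A of L(A) (one representative per
-- flat), the dimensions, decisions of the order, and the Möbius function
-- μ(ℚ^ℓ) = 1, μ(X) = - Σ_{Y ⊋ X} μ(Y).

record IsCharPoly {ℓ} (A : Arrangement ℓ) (p : ℕ → ℤ) : Set₁ where
  field
    m          : ℕ
    rep        : Fin m → SubArr A
    rep-ne     : ∀ k → Nonempty (flat A (rep k))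
    rep-inj    : ∀ k k' → flat A (rep k) ≐ flat A (rep k') → k ≡ k'
    rep-cover  : ∀ B → Nonempty (flat A B) → Σ (Fin m) (λ k → flat A B ≐ flat A (rep k))
    dim        : Fin m → ℕ
    dim-ok     : ∀ k → IsDim (flat A (rep k)) (dim k)
    whole?     : ∀ k → Dec (IsWhole (flat A (rep k)))
    above?     : ∀ k k' → Dec (flat A (rep k) ⊂ₛ flat A (rep k'))
    μ          : Fin m → ℤ
    μ-whole    : ∀ k → IsWhole (flat A (rep k)) → μ k ≡ + 1
    μ-rec      : ∀ k → ¬ IsWhole (flat A (rep k)) →
                 μ k ≡ ℤ.- sumℤ (λ k' → if does (above? k k') then μ k' else + 0)
    coeff      : ∀ d → p d ≡ sumℤ (λ k → if dim k ℕ.≡ᵇ d then μ k else + 0)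

-- Vertex-weighted digraphs and ψ-digraphical arrangements.
-- G is given by a Boolean adjacency E (E i j ≡ true iff (i,j) ∈ E_G),
-- ψ(i) = [a i, b i].

Digraph : ℕ → Set
Digraph ℓ = Fin ℓ → Fin ℓ → Bool

upFrom : ℤ → ℕ → List ℤ
upFrom a zero    = []
upFrom a (suc n) = a ∷ upFrom (a ℤ.+ + 1) n

interval : ℤ → ℤ → List ℤ
interval a b = if a ℤ.≤ᵇ b then upFrom a (suc ℤ.∣ b ℤ.- a ∣) else []

allPairs : (ℓ : ℕ) → List (Fin ℓ × Fin ℓ)
allPairs ℓ = concatMap (λ i → map (λ j → (i , j)) (allFin ℓ)) (allFin ℓ)

psiArr : ∀ {ℓ} → Digraph ℓ → (Fin ℓ → ℤ) → (Fin ℓ → ℤ) → Arrangement ℓ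
psiArr {ℓ} E a b =
     concatMap (λ { (i , j) → if toℕ i ℕ.<ᵇ toℕ j then diffH i j (+ 0) ∷ [] else [] }) (allPairs ℓ)
  ++ concatMap (λ { (i , j) → if E i j then diffH i j (+ 1) ∷ [] else [] }) (allPairs ℓ)
  ++ concatMap (λ i → map (coordH i) (interval (a i) (b i))) (allFin ℓ)

_≟ᵇ_ : ∀ {ℓ} → Fin ℓ → Fin ℓ → Bool
i ≟ᵇ j = does (i Fin.≟ j)

IsCoking : ∀ {ℓ} → Digraph ℓ → Fin ℓ → Set
IsCoking E v = ∀ u → ¬ (u ≡ v) → E u v ≡ true

IsKing : ∀ {ℓ} → Digraph ℓ → Fin ℓ → Set
IsKing E v = ∀ u → ¬ (u ≡ v) → E v u ≡ true

cokingE : ∀ {ℓ} → Digraph ℓ → Fin ℓ → Digraph ℓ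
cokingE E v i j = E i j ∧ not (j ≟ᵇ v)

cokingA : ∀ {ℓ} → (Fin ℓ → ℤ) → Fin ℓ → (Fin ℓ → ℤ)
cokingA a v i = if i ≟ᵇ v then a i else a i ℤ.- + 1

kingE : ∀ {ℓ} → Digraph ℓ → Fin ℓ → Digraph ℓ
kingE E v i j = E i j ∧ not (i ≟ᵇ v)

kingB : ∀ {ℓ} → (Fin ℓ → ℤ) → Fin ℓ → (Fin ℓ → ℤ)
kingB b v i = if i ≟ᵇ v then b i else b i ℤ.+ + 1

{-# OPTIONS --safe #-}

-- By the finite field method χ_A(q) is, for every large q, the number of points of (ℤ/q)^ℓ off all
-- hyperplanes of A; and a polynomial is determined by its values at large q.  Every constraint here
-- has the form x i - x j = c or x i = c, so a flat is described by a rooted forest with integer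
-- potentials, over ℚ and over ℤ/q at once; this gives its dimension, its number q^dim of points
-- modulo q, and a decision procedure for inclusion of flats.
--
-- As 0 ∈ ψ(i), a point off A(G,ψ) modulo q is an integer point with pairwise distinct coordinates,
-- bᵢ < xᵢ < q + aᵢ and xᵢ ≠ xⱼ + 1 for every edge (i,j).  If v is a coking, the place xᵥ + 1 is
-- empty; deleting it, i.e. lowering every coordinate above xᵥ by 1, is a bijection onto the points
-- off A(G′,ψ′).  The reflection x ↦ q - x exchanges kings and cokings.
module Submission where

-- `IsCharPoly` asks for data over ℚ: an enumeration of the flats, their dimensions, decisions of
-- inclusion and the Möbius function. Hence the laws of `IsGain`, common to ℚ and ℤ/q, under which
-- one forest serves all these purposes. Solving the constraints divides nothing, so q runs over all
-- large integers, prime or not. The one discrepancy is a set of hyperplanes that meets modulo q but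
-- not over ℚ: it implies n = 0 for some integer n ≠ 0, and q must divide this n.
--
-- A point modulo q determines the set of hyperplanes through it, hence a smallest flat X₀
-- containing it. It lies on X exactly if X ⊇ X₀, and the sum of μ(X) over these X is 1 if X₀ is the
-- whole space and 0 otherwise. Summed over all points, this counts the points off the arrangement.
--
-- The inclusion of intervals enters through a_v ≤ a_i and b_i - 1 ≤ b_v for i ≠ v. When the place
-- x_v + 1 is deleted, the lowered coordinates must remain above b_i and the others must already lie
-- below the new bound q + a_i - 1; the two inequalities ensure the one and the other.

open import Defs
open import Algebra using (CommutativeMonoid; CommutativeRing)
import Algebra.Properties.CommutativeMonoid.Sum as MonoidSum
import Algebra.Properties.Semiring.Sum as SemiringSum
open import Data.Bool as Bool using (Bool; true; false; if_then_else_; not; _∧_)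
import Data.Bool.Properties as Bool
open import Data.Empty using (⊥-elim)
open import Data.Fin as Fin using (Fin; zero; suc; toℕ; fromℕ<; punchIn)
open import Data.Fin.Induction using (spo-noetherian)
import Data.Fin.Properties as Fin
open import Data.Integer using (ℤ; _≤_; _<_; _-_; _+_; +_; -_; _*_; ∣_∣; -[1+_]; +<+; +≤+; -<-; _≤?_)
open import Data.Integer.Divisibility.Signed as ∣ℤ using (_∣_; divides; _∣?_)
import Data.Integer.DivMod as ℤ
import Data.Integer.Properties as ℤ
open import Data.Integer.Tactic.RingSolver using (solve-∀)
open import Data.List using (List; []; _∷_; length; lookup; filter; cartesianProductWith; map; concatMap; allFin)
open import Data.List.Membership.Propositional using (_∈_)
open import Data.List.Membership.Propositional.Properties
  using (∈-lookup; ∈-filter⁺; ∈-filter⁻; ∈-cartesianProductWith⁺; ∈-allFin; ∈-map⁺; ∈-concatMap⁺)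
import Data.List.Properties as List
open import Data.List.Relation.Unary.All as All using (All; []; _∷_)
import Data.List.Relation.Unary.All.Properties as All
open import Data.List.Relation.Unary.AllPairs using (AllPairs; []; _∷_)
open import Data.List.Relation.Unary.Any as Any using (Any; here; there)
import Data.List.Relation.Unary.Any.Properties as Any
open import Data.List.Relation.Unary.Unique.Propositional using (Unique)
import Data.List.Relation.Unary.Unique.Propositional.Properties as Unique
open import Data.Nat as ℕ using (ℕ; zero; suc)
import Data.Nat.Coprimality as ℕ
import Data.Nat.Divisibility as ℕ
import Data.Nat.ListAction as ℕ
import Data.Nat.Properties as ℕ
open import Data.Product using (Σ; ∃; _×_; _,_; proj₁; proj₂)
open import Data.Rational as ℚ using (ℚ; mkℚ; 0ℚ; 1ℚ)
import Data.Rational.Properties as ℚ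
import Data.Rational.Solver as ℚ
open import Data.Sum as Sum using (_⊎_; inj₁; inj₂)
open import Data.Unit using (⊤; tt)
open import Data.Vec as Vec using (Vec; []; _∷_)
import Data.Vec.Functional as Vector
import Data.Vec.Functional.Properties as Vector
import Data.Vec.Properties as Vec
open import Data.Vec.Relation.Binary.Pointwise.Extensional using (ext; Pointwise-≡⇒≡)
open import Function using (_∘_; const; flip)
open import Function.Bundles using (_⇔_; mk⇔; Equivalence)
open import Induction.WellFounded using (WellFounded; WfRec; module FixPoint) renaming (module All to WF)
open import Relation.Binary using (IsStrictPartialOrder; tri<; tri≈; tri>)
open import Relation.Binary.PropositionalEquality
open import Relation.Nullary using (¬_; Dec; yes; no; contradiction; does)
open import Relation.Nullary.Decidable
  using (decidable-stable; _×-dec_; _→-dec_; ¬?; map′; dec-true; dec-false; toSum)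
open import Relation.Unary using (Decidable)

open Equivalence using (to; from)

-- Gain relations and rooted forests

-- Vertex zero stands for the constant 0, so that x i = c is the constraint (suc i , zero , c).
Constraint : ℕ → Set
Constraint n = Fin n × Fin n × ℤ

-- D i j c is to be read as x i - x j = c for some point x; the three laws below are all that is
-- needed to solve constraints, and hold over ℚ and over ℤ/q alike.
GainRel : ℕ → Set₁
GainRel n = Fin n → Fin n → ℤ → Set

Sat : ∀ {n} → GainRel n → Constraint n → Set
Sat D (i , j , c) = D i j c

record IsGain {n} (D : GainRel n) : Set where
  field
    gain-refl  : ∀ i → D i i (+ 0)
    gain-sym   : ∀ {i j c} → D i j c → D j i (- c)
    gain-trans : ∀ {i j k c e} → D i j c → D j k e → D i k (c + e)

  via : ∀ {i j k c e f} → D i j c → D j k e → c + e ≡ f → D i k f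
  via p q refl = gain-trans p q

-- The constraints x i = x (root i) + pot i.
record Forest (ℓ : ℕ) : Set where
  no-eta-equality
  field
    root      : Fin (suc ℓ) → Fin (suc ℓ)
    pot       : Fin (suc ℓ) → ℤ
    root-root : ∀ i → root (root i) ≡ root i
    pot-root  : ∀ i → pot (root i) ≡ + 0
    root-zero : root zero ≡ zero

open Forest

_⊨_ : ∀ {ℓ} → GainRel (suc ℓ) → Forest ℓ → Set
D ⊨ F = ∀ i → D i (root F i) (pot F i)

discrete : ∀ {ℓ} → Forest ℓ
discrete = record
  { root = λ i → i ; pot = λ _ → + 0
  ; root-root = λ _ → refl ; pot-root = λ _ → refl ; root-zero = refl }

-- The tree of root `p` is hung on the root `q` by x p = x q + e. Requiring `p≢0` keeps vertex zero
-- a root, since its value 0 is not free.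
module Merge {ℓ} (F : Forest ℓ) (p q : Fin (suc ℓ)) (e : ℤ)
  (p-root : root F p ≡ p) (q-root : root F q ≡ q) (p≢q : ¬ p ≡ q) (p≢0 : ¬ p ≡ zero) where

  root′ : Fin (suc ℓ) → Fin (suc ℓ)
  root′ i with root F i Fin.≟ p
  ... | yes _ = q
  ... | no  _ = root F i

  pot′ : Fin (suc ℓ) → ℤ
  pot′ i with root F i Fin.≟ p
  ... | yes _ = pot F i + e
  ... | no  _ = pot F i

  data Case (i : Fin (suc ℓ)) : Set where
    moved : root F i ≡ p → root′ i ≡ q → pot′ i ≡ pot F i + e → Case i
    kept  : ¬ root F i ≡ p → root′ i ≡ root F i → pot′ i ≡ pot F i → Case i

  case : ∀ i → Case i
  case i with root F i Fin.≟ p in eq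
  ... | yes r = moved r lem₁ lem₂
    where
    lem₁ : root′ i ≡ q
    lem₁ rewrite eq = refl
    lem₂ : pot′ i ≡ pot F i + e
    lem₂ rewrite eq = refl
  ... | no r = kept r lem₁ lem₂
    where
    lem₁ : root′ i ≡ root F i
    lem₁ rewrite eq = refl
    lem₂ : pot′ i ≡ pot F i
    lem₂ rewrite eq = refl

  fixed : ∀ i → root F i ≡ i → ¬ i ≡ p → (root′ i ≡ i) × (pot′ i ≡ + 0)
  fixed i r i≢p with case i
  ... | moved r′ _ _ = contradiction (trans (sym r) r′) i≢p
  ... | kept _ a b   = trans a r , trans b (trans (cong (pot F) (sym r)) (pot-root F i))

  fixed-root′ : ∀ i → (root′ (root′ i) ≡ root′ i) × (pot′ (root′ i) ≡ + 0)
  fixed-root′ i with case i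
  ... | moved _ a _ rewrite a = fixed q q-root (p≢q ∘ sym)
  ... | kept r a _  rewrite a = fixed (root F i) (root-root F i) r

  merge : Forest ℓ
  merge = record
    { root = root′ ; pot = pot′
    ; root-root = proj₁ ∘ fixed-root′ ; pot-root = proj₂ ∘ fixed-root′
    ; root-zero = proj₁ (fixed zero (root-zero F) (p≢0 ∘ sym)) }

  merge-⊨ : ∀ {D} → IsGain D → (D p q e × D ⊨ F) ⇔ D ⊨ merge
  merge-⊨ {D} G = mk⇔ fwd bwd
    where
    open IsGain G
    fwd : D p q e × D ⊨ F → D ⊨ merge
    fwd (d , f) i with case i
    ... | moved r a b rewrite a | b = gain-trans (subst (λ z → D i z (pot F i)) r (f i)) d
    ... | kept _ a b  rewrite a | b = f i
    bwd : D ⊨ merge → D p q e × D ⊨ F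
    bwd f = d , g
      where
      d : D p q e
      d with case p | f p
      ... | kept r _ _ | _ = contradiction p-root r
      ... | moved _ a b | fp rewrite a | b =
        subst (D p q) (trans (cong (_+ e) (trans (cong (pot F) (sym p-root)) (pot-root F p))) (ℤ.+-identityˡ e)) fp
      g : D ⊨ F
      g i with case i | f i
      ... | kept _ a b | fi rewrite a | b = fi
      ... | moved r a b | fi rewrite a | b =
        subst (λ z → D i z (pot F i)) (sym r) (via fi (gain-sym d) (lem (pot F i) e))
        where
        lem : ∀ x y → (x + y) + - y ≡ x
        lem = solve-∀

-- What a forest forces syntactically: same tree, right difference of potentials. It is sound for
-- every gain relation and complete over ℚ, so facts established over ℚ pass through it to ℤ/q.
Formal : ∀ {ℓ} → Forest ℓ → Constraint (suc ℓ) → Set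
Formal F (i , j , c) = (root F i ≡ root F j) × (pot F i - pot F j ≡ c)

formal-sound : ∀ {ℓ} {D : GainRel (suc ℓ)} → IsGain D → (F : Forest ℓ) → D ⊨ F →
  ∀ h → Formal F h → Sat D h
formal-sound {D = D} G F f (i , j , c) (r , p) =
  via (f i) (subst (λ z → D z j (- pot F j)) (sym r) (gain-sym (f j))) p
  where open IsGain G

-- `D` is quantified inside each constructor, so that a single forest, or a single impossible gain
-- `n`, is valid over ℚ and for every modulus. A loop of gain `n` is absurd over ℚ; modulo q it says
-- that q divides `n`.
data Solution {ℓ} (S : List (Constraint (suc ℓ))) : Set₁ where
  solvable   : (F : Forest ℓ) → (∀ {D} → IsGain D → All (Sat D) S ⇔ D ⊨ F) → Solution S
  unsolvable : (n : ℤ) → ¬ n ≡ + 0 →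
               (∀ {D} → IsGain D → All (Sat D) S → ∃ λ i → D i i n) → Solution S

module _ {ℓ} {S : List (Constraint (suc ℓ))} (F : Forest ℓ)
  (ok : ∀ {D} → IsGain D → All (Sat D) S ⇔ D ⊨ F) where

  -- The gain that the constraint x i - x j = c imposes between the two roots, after substituting x
  -- = x root + pot.
  gap : Fin (suc ℓ) → Fin (suc ℓ) → ℤ → ℤ
  gap i j c = (- pot F i + c) + pot F j

  gap-sat : ∀ {D} → IsGain D → D ⊨ F → ∀ i j c → D i j c ⇔ D (root F i) (root F j) (gap i j c)
  gap-sat {D} G f i j c = mk⇔
    (λ d → gain-trans (gain-trans (gain-sym (f i)) d) (f j))
    (λ d → via (gain-trans (f i) d) (gain-sym (f j)) (lem (pot F i) c (pot F j)))
    where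
    open IsGain G
    lem : ∀ x y z → (x + ((- x + y) + z)) + - z ≡ y
    lem = solve-∀

  -- Within one tree the new constraint closes a cycle, which is redundant if its gain vanishes and
  -- contradictory otherwise; between two trees it is a new branch.
  extend : ∀ i j c → Solution ((i , j , c) ∷ S)
  extend i j c with root F i Fin.≟ root F j | gap i j c ℤ.≟ + 0 | root F i Fin.≟ zero
  ... | yes r | yes z | _ = solvable F λ G → mk⇔
    (λ { (_ ∷ s) → to (ok G) s })
    (λ f → formal-sound G F f (i , j , c) (r , lem (pot F i) (pot F j) c z) ∷ from (ok G) f)
    where
    lem : ∀ x y c → (- x + c) + y ≡ + 0 → x - y ≡ c
    lem x y c z = trans (lem′ x y c) (trans (cong (λ w → c - w) z) (ℤ.+-identityʳ c))
      where
      lem′ : ∀ x y c → x - y ≡ c - ((- x + c) + y)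
      lem′ = solve-∀
  ... | yes r | no z | _ = unsolvable (gap i j c) z λ { {D} G (d ∷ s) →
    root F i , subst (λ w → D (root F i) w (gap i j c)) (sym r) (to (gap-sat G (to (ok G) s) i j c) d) }
  ... | no r | _ | no p≢0 = solvable merge λ G → mk⇔
    (λ { (d ∷ s) → to (merge-⊨ G) (to (gap-sat G (to (ok G) s) i j c) d , to (ok G) s) })
    (λ f → let (d , f′) = from (merge-⊨ G) f in from (gap-sat G f′ i j c) d ∷ from (ok G) f′)
    where open Merge F (root F i) (root F j) (gap i j c) (root-root F i) (root-root F j) r p≢0
  -- The tree of `i` contains vertex zero and must stay in place, so the tree of `j` is moved, with
  -- the constraint reversed.
  ... | no r | _ | yes p≡0 = solvable merge λ G → mk⇔
    (λ { (d ∷ s) → to (merge-⊨ G)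
      (IsGain.gain-sym G (to (gap-sat G (to (ok G) s) i j c) d) , to (ok G) s) })
    (λ f → let (d , f′) = from (merge-⊨ G) f in
      from (gap-sat G f′ i j c) (flip-back G d) ∷ from (ok G) f′)
    where open Merge F (root F j) (root F i) (- gap i j c) (root-root F j) (root-root F i)
                     (r ∘ sym) (λ q≡0 → r (trans p≡0 (sym q≡0)))
          flip-back : ∀ {D} → IsGain D → D (root F j) (root F i) (- gap i j c) →
                      D (root F i) (root F j) (gap i j c)
          flip-back {D} G d = subst (D (root F i) (root F j)) (ℤ.neg-involutive (gap i j c)) (IsGain.gain-sym G d)

solve-constraints : ∀ {ℓ} (S : List (Constraint (suc ℓ))) → Solution S
solve-constraints [] = solvable discrete λ G → mk⇔ (λ _ → IsGain.gain-refl G) (λ _ → [])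
solve-constraints ((i , j , c) ∷ S) with solve-constraints S
... | solvable F ok        = extend F ok i j c
... | unsolvable n n≢0 bad = unsolvable n n≢0 λ { G (_ ∷ s) → bad G s }

-- Counting and polynomials

AllPairs-lookup : ∀ {a r} {A : Set a} {R : A → A → Set r} → (∀ {x y} → R x y → R y x) →
  ∀ {xs} → AllPairs R xs → ∀ i j → ¬ i ≡ j → R (lookup xs i) (lookup xs j)
AllPairs-lookup R-sym (_ ∷ _)   zero    zero    i≢j = contradiction refl i≢j
AllPairs-lookup R-sym (px ∷ _)  zero    (suc j) i≢j = All.lookup px (∈-lookup j)
AllPairs-lookup R-sym (px ∷ _)  (suc i) zero    i≢j = R-sym (All.lookup px (∈-lookup i))
AllPairs-lookup R-sym (_ ∷ pxs) (suc i) (suc j) i≢j = AllPairs-lookup R-sym pxs i j (i≢j ∘ cong suc)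

Unique-lookup-injective : ∀ {A : Set} {xs : List A} → Unique xs →
  ∀ {i j} → lookup xs i ≡ lookup xs j → i ≡ j
Unique-lookup-injective u {i} {j} eq =
  decidable-stable (i Fin.≟ j) λ i≢j → AllPairs-lookup (_∘ sym) u i j i≢j eq

length-≤ : ∀ {A B : Set} {xs : List A} {ys : List B} (f : A → B) → Unique xs →
  (∀ {x} → x ∈ xs → f x ∈ ys) →
  (∀ {x x′} → x ∈ xs → x′ ∈ xs → f x ≡ f x′ → x ≡ x′) →
  length xs ℕ.≤ length ys
length-≤ {xs = xs} {ys} f u f∈ f-inj = Fin.injective⇒≤ {f = g} g-inj
  where
  g : Fin (length xs) → Fin (length ys)
  g k = Any.index (f∈ (∈-lookup k))
  g-inj : ∀ {k k′} → g k ≡ g k′ → k ≡ k′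
  g-inj {k} {k′} eq = Unique-lookup-injective u (f-inj (∈-lookup k) (∈-lookup k′)
    (trans (Any.lookup-index (f∈ (∈-lookup k)))
      (trans (cong (lookup ys) eq) (sym (Any.lookup-index (f∈ (∈-lookup k′)))))))

vecs : ∀ {A : Set} → List A → ∀ n → List (Vec A n)
vecs xs zero    = [] ∷ []
vecs xs (suc n) = cartesianProductWith _∷_ xs (vecs xs n)

module _ {A : Set} {xs : List A} where

  ∈-vecs : (∀ x → x ∈ xs) → ∀ {n} (v : Vec A n) → v ∈ vecs xs n
  ∈-vecs all []      = here refl
  ∈-vecs all (x ∷ v) = ∈-cartesianProductWith⁺ _∷_ (all x) (∈-vecs all v)

  vecs-unique : Unique xs → ∀ n → Unique (vecs xs n)
  vecs-unique u zero    = [] ∷ []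
  vecs-unique u (suc n) = Unique.cartesianProductWith⁺ _∷_ Vec.∷-injective u (vecs-unique u n)

  length-cartesianProductWith : ∀ {B C : Set} (f : A → B → C) (as : List A) (bs : List B) →
    length (cartesianProductWith f as bs) ≡ length as ℕ.* length bs
  length-cartesianProductWith f []       bs = refl
  length-cartesianProductWith f (a ∷ as) bs = trans (List.length-++ (map (f a) bs))
    (cong₂ ℕ._+_ (List.length-map (f a) bs) (length-cartesianProductWith f as bs))

  length-vecs : ∀ n → length (vecs xs n) ≡ length xs ℕ.^ n
  length-vecs zero    = refl
  length-vecs (suc n) = trans (length-cartesianProductWith _∷_ xs (vecs xs n))
    (cong (length xs ℕ.*_) (length-vecs n))

points : ∀ q ℓ → List (Vec (Fin q) ℓ)
points q = vecs (allFin q)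

∈-points : ∀ {q ℓ} (x : Vec (Fin q) ℓ) → x ∈ points q ℓ
∈-points = ∈-vecs ∈-allFin

points-unique : ∀ q ℓ → Unique (points q ℓ)
points-unique q = vecs-unique (Unique.allFin⁺ q)

length-points : ∀ q ℓ → length (points q ℓ) ≡ q ℕ.^ ℓ
length-points q ℓ = trans (length-vecs ℓ) (cong (ℕ._^ ℓ) (List.length-tabulate {n = q} (λ i → i)))

count : ∀ {A : Set} {P : A → Set} → Decidable P → List A → ℕ
count P? xs = length (filter P? xs)

count-≤ : ∀ {q m n} {P : Vec (Fin q) m → Set} {Q : Vec (Fin q) n → Set}
  (P? : Decidable P) (Q? : Decidable Q) (f : Vec (Fin q) m → Vec (Fin q) n) →
  (∀ x → P x → Q (f x)) → (∀ {x y} → P x → P y → f x ≡ f y → x ≡ y) →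
  count P? (points q m) ℕ.≤ count Q? (points q n)
count-≤ {q} {m} P? Q? f pres inj = length-≤ f (Unique.filter⁺ P? (points-unique q m))
  (λ {x} x∈ → ∈-filter⁺ Q? (∈-points (f x)) (pres x (proj₂ (P∈ x∈))))
  (λ x∈ y∈ → inj (proj₂ (P∈ x∈)) (proj₂ (P∈ y∈)))
  where
  P∈ : ∀ {x} → x ∈ filter P? (points q m) → _
  P∈ = ∈-filter⁻ P? {xs = points q m}

-- Coefficient functions carry no degree, so evaluation is cut off after the first `n` coefficients.
horner : ℕ → (ℕ → ℤ) → ℤ → ℤ
horner zero    p t = + 0
horner (suc n) p t = p 0 + t * horner n (p ∘ suc) t

n<m∣k⇒k≡0 : ∀ {m : ℕ} {k} → ∣ k ∣ ℕ.< m → + m ∣ k → k ≡ + 0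
n<m∣k⇒k≡0 {m} {k} k<m m∣k = ℤ.∣i∣≡0⇒i≡0 (decidable-stable (∣ k ∣ ℕ.≟ 0) λ k≢0 →
  ℕ.<⇒≱ k<m (ℕ.∣⇒≤ {{ℕ.≢-nonZero k≢0}} (∣ℤ.∣⇒∣ᵤ m∣k)))

-- The constant coefficient is divisible by every large q, hence zero; the rest can be divided by q.
horner-vanish : ∀ n (p : ℕ → ℤ) N → (∀ q → N ℕ.< q → horner n p (+ q) ≡ + 0) →
  ∀ d → d ℕ.< n → p d ≡ + 0
horner-vanish (suc n) p N van = vanish
  where
  p₀≡0 : p 0 ≡ + 0
  p₀≡0 = n<m∣k⇒k≡0 (ℕ.s≤s (ℕ.m≤n+m ∣ p 0 ∣ N)) (divides (- horner n (p ∘ suc) t)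
    (trans (lem (p 0) t (horner n (p ∘ suc) t)) (trans
      (cong (λ z → z + (- horner n (p ∘ suc) t) * t) (van _ (ℕ.s≤s (ℕ.m≤m+n N ∣ p 0 ∣)))) (ℤ.+-identityˡ _))))
    where
    t : ℤ
    t = + suc (N ℕ.+ ∣ p 0 ∣)
    lem : ∀ a t b → a ≡ (a + t * b) + (- b) * t
    lem = solve-∀
  vanish : ∀ d → d ℕ.< suc n → p d ≡ + 0
  vanish zero    _           = p₀≡0
  vanish (suc d) (ℕ.s≤s d<n) = horner-vanish n (p ∘ suc) N van′ d d<n
    where
    van′ : ∀ q → N ℕ.< q → horner n (p ∘ suc) (+ q) ≡ + 0
    van′ (suc q) N<q = ℤ.*-cancelˡ-≡ (+ suc q) _ _ (trans (sym (ℤ.+-identityˡ _))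
      (trans (cong (_+ (+ suc q) * horner n (p ∘ suc) (+ suc q)) (sym p₀≡0))
        (trans (van (suc q) N<q) (sym (ℤ.*-zeroʳ (+ suc q))))))

horner-zero : ∀ n t → horner n (λ _ → + 0) t ≡ + 0
horner-zero zero    t = refl
horner-zero (suc n) t = trans (ℤ.+-identityˡ _) (trans (cong (t *_) (horner-zero n t)) (ℤ.*-zeroʳ t))

horner-+ : ∀ n (p p′ : ℕ → ℤ) t → horner n (λ d → p d + p′ d) t ≡ horner n p t + horner n p′ t
horner-+ zero    p p′ t = refl
horner-+ (suc n) p p′ t = trans (cong (λ z → (p 0 + p′ 0) + t * z) (horner-+ n (p ∘ suc) (p′ ∘ suc) t))
  (lem (p 0) (p′ 0) t _ _)
  where
  lem : ∀ a b t x y → (a + b) + t * (x + y) ≡ (a + t * x) + (b + t * y)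
  lem = solve-∀

horner-neg : ∀ n (p : ℕ → ℤ) t → horner n (λ d → - p d) t ≡ - horner n p t
horner-neg zero    p t = refl
horner-neg (suc n) p t = trans (cong (λ z → - p 0 + t * z) (horner-neg n (p ∘ suc) t)) (lem (p 0) t _)
  where
  lem : ∀ a t x → - a + t * (- x) ≡ - (a + t * x)
  lem = solve-∀

horner-monomial : ∀ {n e} c (q : ℕ) → e ℕ.< n →
  horner n (λ d → if e ℕ.≡ᵇ d then c else + 0) (+ q) ≡ c * + (q ℕ.^ e)
horner-monomial {suc n} {zero} c q _ = begin
  c + (+ q) * horner n (λ _ → + 0) (+ q) ≡⟨ cong (λ z → c + (+ q) * z) (horner-zero n (+ q)) ⟩
  c + (+ q) * + 0                        ≡⟨ lem c (+ q) ⟩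
  c * + 1                                ∎
  where
  open ≡-Reasoning
  lem : ∀ c t → c + t * + 0 ≡ c * + 1
  lem = solve-∀
horner-monomial {suc n} {suc e} c q (ℕ.s≤s e<n) = begin
  + 0 + (+ q) * horner n (λ d → if e ℕ.≡ᵇ d then c else + 0) (+ q)
    ≡⟨ cong (λ z → + 0 + (+ q) * z) (horner-monomial c q e<n) ⟩
  + 0 + (+ q) * (c * + (q ℕ.^ e)) ≡⟨ lem (+ q) c _ ⟩
  c * ((+ q) * + (q ℕ.^ e))       ≡⟨ cong (c *_) (ℤ.pos-* q (q ℕ.^ e)) ⟨
  c * + (q ℕ.^ suc e)             ∎
  where
  open ≡-Reasoning
  lem : ∀ t c x → + 0 + t * (c * x) ≡ c * (t * x)
  lem = solve-∀

horner-unique : ∀ n (p p′ : ℕ → ℤ) N → (∀ q → N ℕ.< q → horner n p (+ q) ≡ horner n p′ (+ q)) →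
  ∀ d → d ℕ.< n → p d ≡ p′ d
horner-unique n p p′ N eq d d<n = ℤ.i-j≡0⇒i≡j (p d) (p′ d) (horner-vanish n (λ e → p e - p′ e) N van d d<n)
  where
  van : ∀ q → N ℕ.< q → horner n (λ e → p e - p′ e) (+ q) ≡ + 0
  van q N<q = trans (horner-+ n p (-_ ∘ p′) (+ q))
    (trans (cong₂ _+_ (eq q N<q) (horner-neg n p′ (+ q))) (ℤ.+-inverseʳ (horner n p′ (+ q))))

-- Rational points of a forest

module SingleSum {a ℓ} (M : CommutativeMonoid a ℓ) where
  open CommutativeMonoid M renaming (trans to ≈-trans)
  open MonoidSum M

  sum-single : ∀ {n} (f : Fin n → Carrier) j → (∀ k → ¬ k ≡ j → f k ≈ ε) → sum f ≈ f j
  sum-single {suc n} f j z = ≈-trans (sum-remove {i = j} f) (≈-trans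
    (∙-congˡ (≈-trans (sum-cong-≋ (λ k → z (punchIn j k) (Fin.punchInᵢ≢i j k))) (sum-replicate-zero n)))
    (identityʳ (f j)))

module ∑ℚ = SemiringSum (CommutativeRing.semiring ℚ.+-*-commutativeRing)
open ∑ℚ using () renaming (sum to ∑)
open SingleSum ℚ.+-0-commutativeMonoid using () renaming (sum-single to ∑-single)

sumℚ≡∑ : ∀ {m} (f : Fin m → ℚ) → sumℚ f ≡ ∑ f
sumℚ≡∑ {zero}  f = refl
sumℚ≡∑ {suc m} f = cong (f zero ℚ.+_) (sumℚ≡∑ (f ∘ suc))

∑-zero : ∀ {n} {f : Fin n → ℚ} → (∀ k → f k ≡ 0ℚ) → ∑ f ≡ 0ℚ
∑-zero {n} z = trans (∑ℚ.sum-cong-≗ z) (∑ℚ.sum-replicate-zero n)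

*-≢0 : ∀ {a c} → ¬ a ≡ 0ℚ → ¬ c ≡ 0ℚ → ¬ a ℚ.* c ≡ 0ℚ
*-≢0 {a} {c} a≢0 c≢0 ac≡0 = c≢0 (begin
  c                     ≡⟨ ℚ.*-identityˡ c ⟨
  1ℚ ℚ.* c              ≡⟨ cong (ℚ._* c) (ℚ.*-inverseˡ a) ⟨
  (ℚ.1/ a ℚ.* a) ℚ.* c  ≡⟨ ℚ.*-assoc (ℚ.1/ a) a c ⟩
  ℚ.1/ a ℚ.* (a ℚ.* c)  ≡⟨ cong (ℚ.1/ a ℚ.*_) ac≡0 ⟩
  ℚ.1/ a ℚ.* 0ℚ         ≡⟨ ℚ.*-zeroʳ (ℚ.1/ a) ⟩
  0ℚ                    ∎)
  where
  open ≡-Reasoning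
  instance _ = ℚ.≢-nonZero a≢0

Dependent : ∀ {m n} → (Fin m → Fin n → ℚ) → Set
Dependent {m} v = Σ (Fin m → ℚ) λ c → (∃ λ k → ¬ c k ≡ 0ℚ) × (∀ i → ∑ (λ k → c k ℚ.* v k i) ≡ 0ℚ)

-- Gaussian elimination without division: if a = v k 0 is a nonzero pivot, a dependency c of the
-- vectors a·vⱼ - (vⱼ 0)·v k, j ≠ k, gives the dependency with coefficients a·cⱼ and - Σⱼ cⱼ (vⱼ 0).
dependent : ∀ {n} (v : Fin (suc n) → Fin n → ℚ) → Dependent v
dependent {zero}  v = const 1ℚ , (zero , λ ()) , λ ()
dependent {suc n} v with Fin.all? (λ k → v k zero ℚ.≟ 0ℚ)
... | yes v₀≡0 = let (c , (k , c≢0) , z) = dependent (λ k i → v (suc k) (suc i)) in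
  (0ℚ Vector.∷ c) , (suc k , c≢0) ,
  λ { zero → ∑-zero λ k → trans (cong ((0ℚ Vector.∷ c) k ℚ.*_) (v₀≡0 k)) (ℚ.*-zeroʳ ((0ℚ Vector.∷ c) k))
    ; (suc i) → trans (cong₂ ℚ._+_ (ℚ.*-zeroˡ (v zero (suc i))) (z i)) (ℚ.+-identityˡ 0ℚ) }
... | no v₀≢0 with Fin.¬∀⟶∃¬ _ _ (λ k → v k zero ℚ.≟ 0ℚ) v₀≢0
... | k , a≢0 =
  C , (punchIn k j , subst (λ z → ¬ z ≡ 0ℚ) (sym (Vector.insertAt-punchIn ac k b j)) (*-≢0 a≢0 c≢0)) , vanish
  where
  open ≡-Reasoning
  a : ℚ
  a = v k zero
  u : Fin (suc n) → Fin (suc n) → ℚ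
  u = v ∘ punchIn k
  w : Fin (suc n) → Fin (suc n) → ℚ
  w j i = a ℚ.* u j i ℚ.- u j zero ℚ.* v k i
  ih : Dependent (λ j i → w j (suc i))
  ih = dependent (λ j i → w j (suc i))
  c : Fin (suc n) → ℚ
  c = proj₁ ih
  j : Fin (suc n)
  j = proj₁ (proj₁ (proj₂ ih))
  c≢0 : ¬ c j ≡ 0ℚ
  c≢0 = proj₂ (proj₁ (proj₂ ih))
  ac : Fin (suc n) → ℚ
  ac j = a ℚ.* c j
  b : ℚ
  b = ℚ.- ∑ (λ j → c j ℚ.* u j zero)
  C : Fin (suc (suc n)) → ℚ
  C = Vector.insertAt ac k b
  w₀≡0 : ∀ j → w j zero ≡ 0ℚ
  w₀≡0 j = trans (cong (λ z → a ℚ.* u j zero ℚ.- z) (ℚ.*-comm (u j zero) a)) (ℚ.+-inverseʳ (a ℚ.* u j zero))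
  cw≡0 : ∀ i → ∑ (λ j → c j ℚ.* w j i) ≡ 0ℚ
  cw≡0 zero    = ∑-zero λ j → trans (cong (c j ℚ.*_) (w₀≡0 j)) (ℚ.*-zeroʳ (c j))
  cw≡0 (suc i) = proj₂ (proj₂ ih) i
  split : ∀ c u₀ a x y → a ℚ.* c ℚ.* x ≡ (c ℚ.* (a ℚ.* x ℚ.- u₀ ℚ.* y)) ℚ.+ (c ℚ.* u₀) ℚ.* y
  split = solve 5 (λ c u₀ a x y → a :* c :* x := (c :* (a :* x :- u₀ :* y)) :+ (c :* u₀) :* y) refl
    where open ℚ.+-*-Solver
  cancel : ∀ s y → ℚ.- s ℚ.* y ℚ.+ (0ℚ ℚ.+ s ℚ.* y) ≡ 0ℚ
  cancel = solve 2 (λ s y → :- s :* y :+ (con 0ℚ :+ s :* y) := con 0ℚ) refl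
    where open ℚ.+-*-Solver
  vanish : ∀ i → ∑ (λ k → C k ℚ.* v k i) ≡ 0ℚ
  vanish i = begin
    ∑ (λ k → C k ℚ.* v k i)
      ≡⟨ ∑ℚ.sum-remove {i = k} (λ k → C k ℚ.* v k i) ⟩
    C k ℚ.* v k i ℚ.+ ∑ (λ j → C (punchIn k j) ℚ.* u j i)
      ≡⟨ cong₂ (λ x y → x ℚ.* v k i ℚ.+ y) (Vector.insertAt-lookup ac k b)
           (∑ℚ.sum-cong-≗ λ j → trans (cong (ℚ._* u j i) (Vector.insertAt-punchIn ac k b j))
             (split (c j) (u j zero) a (u j i) (v k i))) ⟩
    b ℚ.* v k i ℚ.+ ∑ (λ j → c j ℚ.* w j i ℚ.+ (c j ℚ.* u j zero) ℚ.* v k i)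
      ≡⟨ cong (b ℚ.* v k i ℚ.+_) (∑ℚ.∑-distrib-+ (λ j → c j ℚ.* w j i) (λ j → (c j ℚ.* u j zero) ℚ.* v k i)) ⟩
    b ℚ.* v k i ℚ.+ (∑ (λ j → c j ℚ.* w j i) ℚ.+ ∑ (λ j → (c j ℚ.* u j zero) ℚ.* v k i))
      ≡⟨ cong₂ (λ x y → b ℚ.* v k i ℚ.+ (x ℚ.+ y)) (cw≡0 i) (sym (∑ℚ.*-distribʳ-sum (v k i) (λ j → c j ℚ.* u j zero))) ⟩
    b ℚ.* v k i ℚ.+ (0ℚ ℚ.+ ∑ (λ j → c j ℚ.* u j zero) ℚ.* v k i)
      ≡⟨ cancel (∑ (λ j → c j ℚ.* u j zero)) (v k i) ⟩
    0ℚ ∎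

-- The quotient by 1 does not reduce for a variable `n`; the literal form exposes numerator and
-- denominator.
ℤ→ℚ-mkℚ : ∀ n → ℤ→ℚ n ≡ mkℚ n 0 (ℕ.sym (ℕ.1-coprimeTo ∣ n ∣))
ℤ→ℚ-mkℚ n = ℚ.↥p/↧p≡p (mkℚ n 0 (ℕ.sym (ℕ.1-coprimeTo ∣ n ∣)))

ℤ→ℚ-injective : ∀ {m n} → ℤ→ℚ m ≡ ℤ→ℚ n → m ≡ n
ℤ→ℚ-injective {m} {n} eq = cong ℚ.↥_ (trans (sym (ℤ→ℚ-mkℚ m)) (trans eq (ℤ→ℚ-mkℚ n)))

ℤ→ℚ-+ : ∀ m n → ℤ→ℚ (m + n) ≡ ℤ→ℚ m ℚ.+ ℤ→ℚ n
ℤ→ℚ-+ m n = sym (trans (cong₂ ℚ._+_ (ℤ→ℚ-mkℚ m) (ℤ→ℚ-mkℚ n))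
  (cong₂ (λ x y → ℤ→ℚ (x + y)) (ℤ.*-identityʳ m) (ℤ.*-identityʳ n)))

ℤ→ℚ-neg : ∀ n → ℤ→ℚ (- n) ≡ ℚ.- ℤ→ℚ n
ℤ→ℚ-neg n = trans (ℤ→ℚ-mkℚ (- n)) (trans (lem n) (cong ℚ.-_ (sym (ℤ→ℚ-mkℚ n))))
  where
  lem : ∀ n → mkℚ (- n) 0 (ℕ.sym (ℕ.1-coprimeTo ∣ - n ∣)) ≡ ℚ.- mkℚ n 0 (ℕ.sym (ℕ.1-coprimeTo ∣ n ∣))
  lem (+ zero)  = refl
  lem (+ suc n) = refl
  lem -[1+ n ]  = refl

_⁺ : ∀ {ℓ} → Point ℓ → Fin (suc ℓ) → ℚ
x ⁺ = 0ℚ Vector.∷ x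

Dℚ : ∀ {ℓ} → Point ℓ → GainRel (suc ℓ)
Dℚ x i j c = (x ⁺) i ℚ.- (x ⁺) j ≡ ℤ→ℚ c

isGainℚ : ∀ {ℓ} (x : Point ℓ) → IsGain (Dℚ x)
isGainℚ x = record
  { gain-refl  = λ i → ℚ.+-inverseʳ ((x ⁺) i)
  ; gain-sym   = λ {i} {j} {c} d → trans (swap ((x ⁺) i) ((x ⁺) j)) (trans (cong ℚ.-_ d) (sym (ℤ→ℚ-neg c)))
  ; gain-trans = λ {i} {j} {k} {c} {e} d d′ →
      trans (tele ((x ⁺) i) ((x ⁺) j) ((x ⁺) k)) (trans (cong₂ ℚ._+_ d d′) (sym (ℤ→ℚ-+ c e))) }
  where
  open ℚ.+-*-Solver
  swap : ∀ a b → b ℚ.- a ≡ ℚ.- (a ℚ.- b)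
  swap = solve 2 (λ a b → b :- a := :- (a :- b)) refl
  tele : ∀ a b c → a ℚ.- c ≡ (a ℚ.- b) ℚ.+ (b ℚ.- c)
  tele = solve 3 (λ a b c → a :- c := (a :- b) :+ (b :- c)) refl

module _ {ℓ} (F : Forest ℓ) where

  pot-zero : pot F zero ≡ + 0
  pot-zero = trans (cong (pot F) (sym (root-zero F))) (pot-root F zero)

  isRoot? : ∀ i → Dec (root F (suc i) ≡ suc i)
  isRoot? i = root F (suc i) Fin.≟ suc i

  -- Only the free roots: vertex zero is a root too, but its value is fixed. Hence their number is
  -- the dimension.
  roots : List (Fin ℓ)
  roots = filter isRoot? (allFin ℓ)

  rank : ℕ
  rank = length roots

  rootAt : Fin rank → Fin ℓ
  rootAt = lookup roots

  rootAt-injective : ∀ {k k′} → rootAt k ≡ rootAt k′ → k ≡ k′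
  rootAt-injective = Unique-lookup-injective (Unique.filter⁺ isRoot? (Unique.allFin⁺ ℓ))

  rank≤ : rank ℕ.≤ ℓ
  rank≤ = Fin.injective⇒≤ rootAt-injective

  root-rootAt : ∀ k → root F (suc (rootAt k)) ≡ suc (rootAt k)
  root-rootAt k = proj₂ (∈-filter⁻ isRoot? {xs = allFin ℓ} (∈-lookup k))

  pot-rootAt : ∀ k → pot F (suc (rootAt k)) ≡ + 0
  pot-rootAt k = trans (cong (pot F) (sym (root-rootAt k))) (pot-root F (suc (rootAt k)))

  root⁺At : Fin (suc rank) → Fin (suc ℓ)
  root⁺At zero    = zero
  root⁺At (suc k) = suc (rootAt k)

  rootIndex : ∀ i → ∃ λ k → root F i ≡ root⁺At k
  rootIndex i with root F i in eq
  ... | zero  = zero , refl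
  ... | suc j = suc (Any.index j∈) , cong suc (Any.lookup-index j∈)
    where j∈ = ∈-filter⁺ isRoot? (∈-allFin j) (subst (λ z → root F z ≡ z) eq (root-root F i))

  -- The entries of `w` at the free roots are arbitrary parameters; its other entries are ignored.
  realize : Point ℓ → Point ℓ
  realize w i = (w ⁺) (root F (suc i)) ℚ.+ ℤ→ℚ (pot F (suc i))

  realize⁺ : ∀ w i → (realize w ⁺) i ≡ (w ⁺) (root F i) ℚ.+ ℤ→ℚ (pot F i)
  realize⁺ w (suc i) = refl
  realize⁺ w zero    = cong₂ (λ r p → (w ⁺) r ℚ.+ ℤ→ℚ p) (sym (root-zero F)) (sym pot-zero)

  realize-⊨ : ∀ w → Dℚ (realize w) ⊨ F
  realize-⊨ w i = begin
    (realize w ⁺) i ℚ.- (realize w ⁺) (root F i)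
      ≡⟨ cong₂ ℚ._-_ (realize⁺ w i) (trans (realize⁺ w (root F i))
           (cong₂ (λ r p → (w ⁺) r ℚ.+ ℤ→ℚ p) (root-root F i) (pot-root F i))) ⟩
    ((w ⁺) (root F i) ℚ.+ ℤ→ℚ (pot F i)) ℚ.- ((w ⁺) (root F i) ℚ.+ 0ℚ)
      ≡⟨ lem ((w ⁺) (root F i)) (ℤ→ℚ (pot F i)) ⟩
    ℤ→ℚ (pot F i) ∎
    where
    open ≡-Reasoning
    lem : ∀ a b → (a ℚ.+ b) ℚ.- (a ℚ.+ 0ℚ) ≡ b
    lem = solve 2 (λ a b → (a :+ b) :- (a :+ con 0ℚ) := b) refl
      where open ℚ.+-*-Solver

unit : ∀ {ℓ} → Fin ℓ → Point ℓ
unit j i = if does (i Fin.≟ j) then 1ℚ else 0ℚ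

unit-≡ : ∀ {ℓ} (j : Fin ℓ) → unit j j ≡ 1ℚ
unit-≡ j with j Fin.≟ j
... | yes _  = refl
... | no j≢j = contradiction refl j≢j

unit-≢ : ∀ {ℓ} {i j : Fin ℓ} → ¬ i ≡ j → unit j i ≡ 0ℚ
unit-≢ {i = i} {j} i≢j with i Fin.≟ j
... | yes i≡j = contradiction i≡j i≢j
... | no _    = refl

separate : ∀ {ℓ} (i j : Fin (suc ℓ)) → (∀ w → (w ⁺) i ≡ (w ⁺) j) → i ≡ j
separate i j eq with i Fin.≟ j
separate i j eq | yes i≡j = i≡j
separate zero zero eq | no i≢j = contradiction refl i≢j
separate (suc i) zero eq | no _ = contradiction (trans (sym (unit-≡ i)) (eq (unit i))) λ ()
separate zero (suc j) eq | no _ = contradiction (trans (sym (unit-≡ j)) (sym (eq (unit j)))) λ ()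
separate (suc i) (suc j) eq | no i≢j =
  contradiction (trans (sym (unit-≡ i)) (trans (eq (unit i)) (unit-≢ (i≢j ∘ cong suc ∘ sym)))) λ ()

-- Test `h` on the points `realize F w`. For w = 0 only the potentials remain, which gives their
-- difference; for arbitrary `w` it follows that the two roots always carry equal values, and unit
-- vectors then separate distinct roots.
formal-complete : ∀ {ℓ} (F : Forest ℓ) h → (∀ x → Dℚ x ⊨ F → Sat (Dℚ x) h) → Formal F h
formal-complete F (i , j , c) sat = separate (root F i) (root F j) roots≡ , pots≡
  where
  open ≡-Reasoning
  eqn : ∀ w → ((w ⁺) (root F i) ℚ.+ ℤ→ℚ (pot F i)) ℚ.- ((w ⁺) (root F j) ℚ.+ ℤ→ℚ (pot F j)) ≡ ℤ→ℚ c
  eqn w = trans (sym (cong₂ ℚ._-_ (realize⁺ F w i) (realize⁺ F w j))) (sat (realize F w) (realize-⊨ F w))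
  0⁺ : ∀ {n} (k : Fin (suc n)) → ((const 0ℚ) ⁺) k ≡ 0ℚ
  0⁺ zero    = refl
  0⁺ (suc k) = refl
  pots≡ : pot F i - pot F j ≡ c
  pots≡ = ℤ→ℚ-injective (begin
    ℤ→ℚ (pot F i - pot F j)                               ≡⟨ ℤ→ℚ-+ (pot F i) (- pot F j) ⟩
    ℤ→ℚ (pot F i) ℚ.+ ℤ→ℚ (- pot F j)                     ≡⟨ cong (ℤ→ℚ (pot F i) ℚ.+_) (ℤ→ℚ-neg (pot F j)) ⟩
    ℤ→ℚ (pot F i) ℚ.- ℤ→ℚ (pot F j)
      ≡⟨ cong₂ ℚ._-_ (ℚ.+-identityˡ (ℤ→ℚ (pot F i))) (ℚ.+-identityˡ (ℤ→ℚ (pot F j))) ⟨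
    (0ℚ ℚ.+ ℤ→ℚ (pot F i)) ℚ.- (0ℚ ℚ.+ ℤ→ℚ (pot F j))
      ≡⟨ cong₂ (λ x y → (x ℚ.+ ℤ→ℚ (pot F i)) ℚ.- (y ℚ.+ ℤ→ℚ (pot F j)))
            (0⁺ (root F i)) (0⁺ (root F j)) ⟨
    ((const 0ℚ ⁺) (root F i) ℚ.+ ℤ→ℚ (pot F i)) ℚ.- ((const 0ℚ ⁺) (root F j) ℚ.+ ℤ→ℚ (pot F j)) ≡⟨ eqn (const 0ℚ) ⟩
    ℤ→ℚ c ∎)
  roots≡ : ∀ w → (w ⁺) (root F i) ≡ (w ⁺) (root F j)
  roots≡ w = begin
    (w ⁺) (root F i)
      ≡⟨ lem ((w ⁺) (root F i)) ((w ⁺) (root F j)) (ℤ→ℚ (pot F i)) (ℤ→ℚ (pot F j)) ⟩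
    (((w ⁺) (root F i) ℚ.+ ℤ→ℚ (pot F i)) ℚ.- ((w ⁺) (root F j) ℚ.+ ℤ→ℚ (pot F j)))
      ℚ.+ ((w ⁺) (root F j) ℚ.- (ℤ→ℚ (pot F i) ℚ.- ℤ→ℚ (pot F j)))
      ≡⟨ cong₂ (λ x y → x ℚ.+ ((w ⁺) (root F j) ℚ.- y)) (eqn w)
           (trans (cong (ℤ→ℚ (pot F i) ℚ.+_) (sym (ℤ→ℚ-neg (pot F j))))
             (trans (sym (ℤ→ℚ-+ (pot F i) (- pot F j))) (cong ℤ→ℚ pots≡))) ⟩
    ℤ→ℚ c ℚ.+ ((w ⁺) (root F j) ℚ.- ℤ→ℚ c)
      ≡⟨ lem₂ (ℤ→ℚ c) ((w ⁺) (root F j)) ⟩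
    (w ⁺) (root F j) ∎
    where
    open ℚ.+-*-Solver
    lem : ∀ x y a b → x ≡ ((x ℚ.+ a) ℚ.- (y ℚ.+ b)) ℚ.+ (y ℚ.- (a ℚ.- b))
    lem = solve 4 (λ x y a b → x := ((x :+ a) :- (y :+ b)) :+ (y :- (a :- b))) refl
    lem₂ : ∀ c y → c ℚ.+ (y ℚ.- c) ≡ y
    lem₂ = solve 2 (λ c y → c :+ (y :- c) := y) refl

formal? : ∀ {ℓ} (F : Forest ℓ) h → Dec (Formal F h)
formal? F (i , j , c) = (root F i Fin.≟ root F j) ×-dec (pot F i - pot F j ℤ.≟ c)

-- The points with all free roots at 0, or one of them at 1 and the rest at 0, are affinely
-- independent, as the root coordinates recover the coefficients. Conversely, the root coordinates
-- determine every other coordinate up to a constant, which bounds the number of independent points.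
isDim-forest : ∀ {ℓ} (F : Forest ℓ) (S : PSet ℓ) → (∀ x → S x ⇔ Dℚ x ⊨ F) → IsDim S (rank F)
isDim-forest {ℓ} F S S⇔F = (basis , (λ k → from (S⇔F _) (realize-⊨ F (dir k))) , independent) , maximal
  where
  open ≡-Reasoning
  dir : Fin (suc (rank F)) → Point ℓ
  dir zero    = const 0ℚ
  dir (suc k) = unit (rootAt F k)
  basis : Fin (suc (rank F)) → Point ℓ
  basis = realize F ∘ dir
  basis-rootAt : ∀ k j → basis k (rootAt F j) ≡ dir k (rootAt F j)
  basis-rootAt k j = trans (cong₂ (λ r p → (dir k ⁺) r ℚ.+ ℤ→ℚ p) (root-rootAt F j) (pot-rootAt F j))
    (ℚ.+-identityʳ (dir k (rootAt F j)))
  independent : AffInd basis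
  independent c Σc≡0 Σcp≡0 = all-zero
    where
    tail-zero : ∀ j → c (suc j) ≡ 0ℚ
    tail-zero j = begin
      c (suc j)                                               ≡⟨ ℚ.*-identityʳ _ ⟨
      c (suc j) ℚ.* 1ℚ                                        ≡⟨ cong (c (suc j) ℚ.*_) (unit-≡ (rootAt F j)) ⟨
      c (suc j) ℚ.* dir (suc j) (rootAt F j)
        ≡⟨ ∑-single (λ k → c k ℚ.* dir k (rootAt F j)) (suc j) other ⟨
      ∑ (λ k → c k ℚ.* dir k (rootAt F j))
        ≡⟨ ∑ℚ.sum-cong-≗ (λ k → cong (c k ℚ.*_) (basis-rootAt k j)) ⟨
      ∑ (λ k → c k ℚ.* basis k (rootAt F j))                  ≡⟨ sumℚ≡∑ (λ k → c k ℚ.* basis k (rootAt F j)) ⟨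
      sumℚ (λ k → c k ℚ.* basis k (rootAt F j))               ≡⟨ Σcp≡0 (rootAt F j) ⟩
      0ℚ                                                      ∎
      where
      other : ∀ k → ¬ k ≡ suc j → c k ℚ.* dir k (rootAt F j) ≡ 0ℚ
      other zero    _   = ℚ.*-zeroʳ (c zero)
      other (suc k) k≢j = trans
        (cong (c (suc k) ℚ.*_) (unit-≢ (k≢j ∘ cong suc ∘ sym ∘ rootAt-injective F)))
        (ℚ.*-zeroʳ (c (suc k)))
    all-zero : ∀ k → c k ≡ 0ℚ
    all-zero (suc k) = tail-zero k
    all-zero zero    = begin
      c zero                    ≡⟨ ∑-single c zero other ⟨
      ∑ c                       ≡⟨ sumℚ≡∑ c ⟨
      sumℚ c                    ≡⟨ Σc≡0 ⟩
      0ℚ                        ∎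
      where
      other : ∀ k → ¬ k ≡ zero → c k ≡ 0ℚ
      other zero    0≢0 = contradiction refl 0≢0
      other (suc k) _   = tail-zero k
  maximal : (p : Fin (suc (suc (rank F))) → Point ℓ) → (∀ k → S (p k)) → ¬ AffInd p
  maximal p p∈S ind = c≢0 (ind c (trans (sumℚ≡∑ c) Σc≡0) (λ i → trans (sumℚ≡∑ (λ k → c k ℚ.* p k i)) (Σcp≡0 i)) k)
    where
    -- The additional coordinate 1 forces the coefficients of a dependency to sum to 0. This makes
    -- the dependency affine and also cancels the constants `κ` below.
    v : Fin (suc (suc (rank F))) → Fin (suc (rank F)) → ℚ
    v k zero    = 1ℚ
    v k (suc j) = p k (rootAt F j)
    dep : Dependent v
    dep = dependent v
    c = proj₁ dep
    k = proj₁ (proj₁ (proj₂ dep))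
    c≢0 = proj₂ (proj₁ (proj₂ dep))
    Σc≡0 : ∑ c ≡ 0ℚ
    Σc≡0 = trans (∑ℚ.sum-cong-≗ (λ k → sym (ℚ.*-identityʳ (c k)))) (proj₂ (proj₂ dep) zero)
    Σc⁺≡0 : ∀ j → ∑ (λ k → c k ℚ.* (p k ⁺) (root⁺At F j)) ≡ 0ℚ
    Σc⁺≡0 zero    = ∑-zero λ k → ℚ.*-zeroʳ (c k)
    Σc⁺≡0 (suc j) = proj₂ (proj₂ dep) (suc j)
    Σcp≡0 : ∀ i → ∑ (λ k → c k ℚ.* p k i) ≡ 0ℚ
    Σcp≡0 i = begin
      ∑ (λ k → c k ℚ.* p k i)
        ≡⟨ ∑ℚ.sum-cong-≗ (λ k → split k) ⟩
      ∑ (λ k → c k ℚ.* (p k ⁺) (root⁺At F j) ℚ.+ c k ℚ.* κ)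
        ≡⟨ ∑ℚ.∑-distrib-+ (λ k → c k ℚ.* (p k ⁺) (root⁺At F j)) (λ k → c k ℚ.* κ) ⟩
      ∑ (λ k → c k ℚ.* (p k ⁺) (root⁺At F j)) ℚ.+ ∑ (λ k → c k ℚ.* κ)
        ≡⟨ cong₂ ℚ._+_ (Σc⁺≡0 j) (sym (∑ℚ.*-distribʳ-sum κ c)) ⟩
      0ℚ ℚ.+ ∑ c ℚ.* κ
        ≡⟨ cong (λ z → 0ℚ ℚ.+ z ℚ.* κ) Σc≡0 ⟩
      0ℚ ℚ.+ 0ℚ ℚ.* κ
        ≡⟨ cong (0ℚ ℚ.+_) (ℚ.*-zeroˡ κ) ⟩
      0ℚ ∎
      where
      κ : ℚ
      κ = ℤ→ℚ (pot F (suc i))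
      j : Fin (suc (rank F))
      j = proj₁ (rootIndex F (suc i))
      lem : ∀ c x y → c ℚ.* x ≡ c ℚ.* y ℚ.+ c ℚ.* (x ℚ.- y)
      lem = solve 3 (λ c x y → c :* x := c :* y :+ c :* (x :- y)) refl
        where open ℚ.+-*-Solver
      split : ∀ k → c k ℚ.* p k i ≡ c k ℚ.* (p k ⁺) (root⁺At F j) ℚ.+ c k ℚ.* κ
      split k = trans (lem (c k) (p k i) ((p k ⁺) (root⁺At F j)))
        (cong (λ z → c k ℚ.* (p k ⁺) (root⁺At F j) ℚ.+ c k ℚ.* z)
          (subst (λ r → p k i ℚ.- (p k ⁺) r ≡ κ) (proj₂ (rootIndex F (suc i))) (to (S⇔F (p k)) (p∈S k) (suc i))))

-- Points of a forest modulo q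

∣-resp : ∀ {q a b : ℤ} → a ≡ b → q ∣ a → q ∣ b
∣-resp refl d = d

Dmod : ∀ {ℓ} → ℕ → (Fin ℓ → ℤ) → GainRel (suc ℓ)
Dmod q x i j c = + q ∣ ((+ 0 Vector.∷ x) i - (+ 0 Vector.∷ x) j) - c

Dmod? : ∀ {ℓ} q (x : Fin ℓ → ℤ) i j c → Dec (Dmod q x i j c)
Dmod? q x i j c = + q ∣? _

isGainMod : ∀ {ℓ} q (x : Fin ℓ → ℤ) → IsGain (Dmod q x)
isGainMod q x = record
  { gain-refl  = λ i → divides (+ 0) (lem₀ (x⁺ i))
  ; gain-sym   = λ {i} {j} {c} d → ∣-resp (lem₁ (x⁺ i) (x⁺ j) c) (∣ℤ.∣m⇒∣-m d)
  ; gain-trans = λ {i} {j} {k} {c} {e} d d′ →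
      ∣-resp (lem₂ (x⁺ i) (x⁺ j) (x⁺ k) c e) (∣ℤ.∣m∣n⇒∣m+n d d′) }
  where
  x⁺ = + 0 Vector.∷ x
  lem₀ : ∀ a → (a - a) - + 0 ≡ + 0
  lem₀ = solve-∀
  lem₁ : ∀ a b c → - ((a - b) - c) ≡ (b - a) - - c
  lem₁ = solve-∀
  lem₂ : ∀ a b d c e → ((a - b) - c) + ((b - d) - e) ≡ (a - d) - (c + e)
  lem₂ = solve-∀

val : ∀ {q ℓ} → Vec (Fin q) ℓ → Fin ℓ → ℤ
val x i = + toℕ (Vec.lookup x i)

residue : ∀ q .{{_ : ℕ.NonZero q}} → ℤ → Fin q
residue q z = fromℕ< (ℤ.n%ℕd<d z q)

residue-∣ : ∀ q .{{_ : ℕ.NonZero q}} z → + q ∣ + toℕ (residue q z) - z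
residue-∣ q z = divides (- (z ℤ./ℕ q)) (trans
  (cong₂ (λ r z → + r - z) (Fin.toℕ-fromℕ< (ℤ.n%ℕd<d z q)) (ℤ.a≡a%ℕn+[a/ℕn]*n z q))
  (lem (+ (z ℤ.%ℕ q)) (z ℤ./ℕ q) (+ q)))
  where
  lem : ∀ r s t → r - (r + s * t) ≡ - s * t
  lem = solve-∀

congruent⇒≡ : ∀ {q} (i j : Fin q) → + q ∣ + toℕ i - + toℕ j → i ≡ j
congruent⇒≡ {q} i j d = Fin.toℕ-injective (ℤ.+-injective (ℤ.i-j≡0⇒i≡j (+ toℕ i) (+ toℕ j) (n<m∣k⇒k≡0 small d)))
  where
  small : ∣ + toℕ i - + toℕ j ∣ ℕ.< q
  small = ℕ.≤-<-trans (ℕ.≤-reflexive (cong ∣_∣ (ℤ.m-n≡m⊖n (toℕ i) (toℕ j))))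
    (ℕ.≤-<-trans (ℤ.∣m⊝n∣≤m⊔n (toℕ i) (toℕ j)) (ℕ.⊔-lub (Fin.toℕ<n i) (Fin.toℕ<n j)))

lookup-injective : ∀ {A : Set} {n} {x y : Vec A n} → (∀ i → Vec.lookup x i ≡ Vec.lookup y i) → x ≡ y
lookup-injective eq = Pointwise-≡⇒≡ (ext eq)

⊨mod? : ∀ {ℓ} q (F : Forest ℓ) (x : Vec (Fin q) ℓ) → Dec (Dmod q (val x) ⊨ F)
⊨mod? q F x = Fin.all? λ i → Dmod? q (val x) i (root F i) (pot F i)

module _ {ℓ} (F : Forest ℓ) (q : ℕ) .{{_ : ℕ.NonZero q}} where

  restrict : Vec (Fin q) ℓ → Vec (Fin q) (rank F)
  restrict x = Vec.tabulate (Vec.lookup x ∘ rootAt F)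

  restrict-injective : ∀ {x y} → Dmod q (val x) ⊨ F → Dmod q (val y) ⊨ F → restrict x ≡ restrict y → x ≡ y
  restrict-injective {x} {y} fx fy eq = lookup-injective λ i → congruent⇒≡ _ _
    (∣-resp (lem (val x i) (val y i) ((+ 0 Vector.∷ val x) (root⁺At F (proj₁ (rootIndex F (suc i))))) (pot F (suc i)))
      (∣ℤ.∣m∣n⇒∣m-n (at x fx i) (subst (λ r → + q ∣ (val y i - r) - pot F (suc i))
        (sym (roots≡ (proj₁ (rootIndex F (suc i))))) (at y fy i))))
    where
    at : ∀ x → Dmod q (val x) ⊨ F → ∀ i →
      + q ∣ (val x i - (+ 0 Vector.∷ val x) (root⁺At F (proj₁ (rootIndex F (suc i))))) - pot F (suc i)
    at x f i = subst
      (λ r → + q ∣ (val x i - (+ 0 Vector.∷ val x) r) - pot F (suc i)) (proj₂ (rootIndex F (suc i))) (f (suc i))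
    roots≡ : ∀ k → (+ 0 Vector.∷ val x) (root⁺At F k) ≡ (+ 0 Vector.∷ val y) (root⁺At F k)
    roots≡ zero    = refl
    roots≡ (suc k) = cong (λ z → + toℕ z) (trans (sym (Vec.lookup∘tabulate _ k))
      (trans (cong (λ z → Vec.lookup z k) eq) (Vec.lookup∘tabulate _ k)))
    lem : ∀ a b r p → ((a - r) - p) - ((b - r) - p) ≡ a - b
    lem = solve-∀

  spread : Vec (Fin q) (rank F) → Fin (suc ℓ) → ℤ
  spread y i = (+ 0 Vector.∷ val y) (proj₁ (rootIndex F i)) + pot F i

  extendMod : Vec (Fin q) (rank F) → Vec (Fin q) ℓ
  extendMod y = Vec.tabulate (residue q ∘ spread y ∘ suc)

  root⁺At-injective : ∀ {k k′} → root⁺At F k ≡ root⁺At F k′ → k ≡ k′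
  root⁺At-injective {zero}  {zero}   _  = refl
  root⁺At-injective {suc k} {suc k′} eq = cong suc (rootAt-injective F (Fin.suc-injective eq))

  index-≡ : ∀ {i k} → root F i ≡ root⁺At F k → proj₁ (rootIndex F i) ≡ k
  index-≡ {i} eq = root⁺At-injective (trans (sym (proj₂ (rootIndex F i))) eq)

  extendMod-∣ : ∀ y i → + q ∣ (+ 0 Vector.∷ val (extendMod y)) i - spread y i
  extendMod-∣ y (suc i) = subst (λ r → + q ∣ + toℕ r - spread y (suc i))
    (sym (Vec.lookup∘tabulate (residue q ∘ spread y ∘ suc) i)) (residue-∣ q (spread y (suc i)))
  extendMod-∣ y zero = divides (+ 0) (cong₂ (λ k p → + 0 - ((+ 0 Vector.∷ val y) k + p))
    (index-≡ {zero} {zero} (root-zero F)) (pot-zero F))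

  extendMod-⊨ : ∀ y → Dmod q (val (extendMod y)) ⊨ F
  extendMod-⊨ y i = ∣-resp (lem (x⁺ i) (x⁺ (root F i)) (Y (proj₁ (rootIndex F i))) (pot F i))
    (∣ℤ.∣m∣n⇒∣m-n (extendMod-∣ y i) (∣-resp (cong₂ (λ k p → x⁺ (root F i) - (Y k + p))
      (index-≡ (trans (root-root F i) (proj₂ (rootIndex F i)))) (pot-root F i)) (extendMod-∣ y (root F i))))
    where
    x⁺ = + 0 Vector.∷ val (extendMod y)
    Y = + 0 Vector.∷ val y
    lem : ∀ a b y p → (a - (y + p)) - (b - (y + + 0)) ≡ (a - b) - p
    lem = solve-∀

  extendMod-injective : ∀ {y z} → extendMod y ≡ extendMod z → y ≡ z
  extendMod-injective {y} {z} eq = lookup-injective λ k → congruent⇒≡ _ _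
    (∣-resp (lem (val (extendMod z) (rootAt F k)) (val y k) (val z k))
      (∣ℤ.∣m∣n⇒∣m-n (at z k) (subst (λ x → + q ∣ val x (rootAt F k) - (val y k + + 0)) eq (at y k))))
    where
    at : ∀ y k → + q ∣ val (extendMod y) (rootAt F k) - (val y k + + 0)
    at y k = ∣-resp (cong₂ (λ k′ p → val (extendMod y) (rootAt F k) - ((+ 0 Vector.∷ val y) k′ + p))
      (index-≡ (root-rootAt F k)) (pot-rootAt F k)) (extendMod-∣ y (suc (rootAt F k)))
    lem : ∀ x y z → (x - (z + + 0)) - (x - (y + + 0)) ≡ y - z
    lem = solve-∀

  -- Restriction to the roots and extension along the trees are injections in opposite directions,
  -- and the values at the free roots are arbitrary residues.
  count-flat : count (⊨mod? q F) (points q ℓ) ≡ q ℕ.^ rank F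
  count-flat = trans (ℕ.≤-antisym
    (count-≤ (⊨mod? q F) all? restrict (λ _ _ → tt) restrict-injective)
    (count-≤ all? (⊨mod? q F) extendMod (λ y _ → extendMod-⊨ y) (λ _ _ → extendMod-injective)))
    (trans (cong length (List.filter-all all? (All.universal (λ _ → tt) (points q (rank F))))) (length-points q (rank F)))
    where
    all? : (y : Vec (Fin q) (rank F)) → Dec ⊤
    all? _ = yes tt

-- The characteristic polynomial and the finite field method

module ∑ℤ = SemiringSum (CommutativeRing.semiring ℤ.+-*-commutativeRing)
open SingleSum ℤ.+-0-commutativeMonoid using () renaming (sum-single to ∑ℤ-single)

sumℤ≡∑ : ∀ {m} (f : Fin m → ℤ) → sumℤ f ≡ ∑ℤ.sum f
sumℤ≡∑ {zero}  f = refl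
sumℤ≡∑ {suc m} f = cong (λ z → f zero + z) (sumℤ≡∑ (f ∘ suc))

sumℤ-cong : ∀ {m} {f g : Fin m → ℤ} → (∀ k → f k ≡ g k) → sumℤ f ≡ sumℤ g
sumℤ-cong {f = f} {g} eq = trans (sumℤ≡∑ f) (trans (∑ℤ.sum-cong-≗ eq) (sym (sumℤ≡∑ g)))

sumℤ-+ : ∀ {m} (f g : Fin m → ℤ) → sumℤ (λ k → f k + g k) ≡ sumℤ f + sumℤ g
sumℤ-+ f g = trans (sumℤ≡∑ (λ k → f k + g k)) (trans (∑ℤ.∑-distrib-+ f g)
  (sym (cong₂ _+_ (sumℤ≡∑ f) (sumℤ≡∑ g))))

sumℤ-zero : ∀ {m} {f : Fin m → ℤ} → (∀ k → f k ≡ + 0) → sumℤ f ≡ + 0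
sumℤ-zero {m} z = trans (sumℤ-cong z) (trans (sumℤ≡∑ {m} (const (+ 0))) (∑ℤ.sum-replicate-zero m))

sumℤ-single : ∀ {m} (f : Fin m → ℤ) j → (∀ k → ¬ k ≡ j → f k ≡ + 0) → sumℤ f ≡ f j
sumℤ-single f j z = trans (sumℤ≡∑ f) (∑ℤ-single f j z)

horner-sumℤ : ∀ n {m} (f : Fin m → ℕ → ℤ) t →
  horner n (λ d → sumℤ (λ k → f k d)) t ≡ sumℤ (λ k → horner n (f k) t)
horner-sumℤ n {zero}  f t = horner-zero n t
horner-sumℤ n {suc m} f t = trans (horner-+ n (f zero) (λ d → sumℤ (λ k → f (suc k) d)) t)
  (cong (λ z → horner n (f zero) t + z) (horner-sumℤ n (f ∘ suc) t))

count-∷ : ∀ {A : Set} {P : A → Set} (P? : Decidable P) x xs →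
  + count P? (x ∷ xs) ≡ (if does (P? x) then + 1 else + 0) + + count P? xs
count-∷ P? x xs with does (P? x)
... | true  = refl
... | false = refl

-- Double counting. It is applied with the Möbius function as `μ`, with `P k` saying that a point
-- lies on the flat `k`, and with `Q` saying that it lies off all hyperplanes.
sumℤ-count : ∀ {A : Set} {m} (μ : Fin m → ℤ) {P : Fin m → A → Set} {Q : A → Set}
  (P? : ∀ k → Decidable (P k)) (Q? : Decidable Q) →
  (∀ x → sumℤ (λ k → if does (P? k x) then μ k else + 0) ≡ (if does (Q? x) then + 1 else + 0)) →
  ∀ xs → sumℤ (λ k → μ k * + count (P? k) xs) ≡ + count Q? xs
sumℤ-count μ P? Q? eq []       = sumℤ-zero λ k → ℤ.*-zeroʳ (μ k)
sumℤ-count μ P? Q? eq (x ∷ xs) = begin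
  sumℤ (λ k → μ k * + count (P? k) (x ∷ xs))
    ≡⟨ sumℤ-cong (λ k → trans (cong (μ k *_) (count-∷ (P? k) x xs)) (split k)) ⟩
  sumℤ (λ k → (if does (P? k x) then μ k else + 0) + μ k * + count (P? k) xs)
    ≡⟨ sumℤ-+ (λ k → if does (P? k x) then μ k else + 0) (λ k → μ k * + count (P? k) xs) ⟩
  sumℤ (λ k → if does (P? k x) then μ k else + 0) + sumℤ (λ k → μ k * + count (P? k) xs)
    ≡⟨ cong₂ _+_ (eq x) (sumℤ-count μ P? Q? eq xs) ⟩
  (if does (Q? x) then + 1 else + 0) + + count Q? xs
    ≡⟨ count-∷ Q? x xs ⟨
  + count Q? (x ∷ xs) ∎
  where
  open ≡-Reasoning
  one : ∀ a n → a * (+ 1 + n) ≡ a + a * n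
  one = solve-∀
  none : ∀ a n → a * (+ 0 + n) ≡ + 0 + a * n
  none = solve-∀
  split : ∀ k → μ k * ((if does (P? k x) then + 1 else + 0) + + count (P? k) xs) ≡
    (if does (P? k x) then μ k else + 0) + μ k * + count (P? k) xs
  split k with does (P? k x)
  ... | true  = one (μ k) (+ count (P? k) xs)
  ... | false = none (μ k) (+ count (P? k) xs)

-- Solving and comparing the flats of an arrangement

hom : ∀ {ℓ} → Hyp ℓ → Constraint (suc ℓ)
hom (diffH i j c) = suc i , suc j , c
hom (coordH i c)  = suc i , zero , c

∈H⇔ : ∀ {ℓ} {x : Point ℓ} h → x ∈H h ⇔ Sat (Dℚ x) (hom h)
∈H⇔ (diffH i j c)        = mk⇔ (λ p → p) (λ p → p)
∈H⇔ {x = x} (coordH i c) = mk⇔ (trans (ℚ.+-identityʳ (x i))) (trans (sym (ℚ.+-identityʳ (x i))))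

Flat : ∀ {ℓ} → GainRel (suc ℓ) → (A : Arrangement ℓ) → SubArr A → Set
Flat D A B = ∀ k → B k ≡ true → Sat D (hom (lookup A k))

flat⇔Flat : ∀ {ℓ} (A : Arrangement ℓ) B x → flat A B x ⇔ Flat (Dℚ x) A B
flat⇔Flat A B x = mk⇔ (λ f k b → to (∈H⇔ (lookup A k)) (f k b)) (λ f k b → from (∈H⇔ (lookup A k)) (f k b))

constraints : ∀ {ℓ} (A : Arrangement ℓ) → SubArr A → List (Constraint (suc ℓ))
constraints []      B = []
constraints (h ∷ A) B = if B zero then hom h ∷ constraints A (B ∘ suc) else constraints A (B ∘ suc)

Flat⇔constraints : ∀ {ℓ} (A : Arrangement ℓ) B {D} → Flat D A B ⇔ All (Sat D) (constraints A B)
Flat⇔constraints []      B = mk⇔ (λ _ → []) (λ _ ())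
Flat⇔constraints (h ∷ A) B with B zero in eq
... | true  = mk⇔ (λ f → f zero eq ∷ to rest (f ∘ suc))
  λ { (p ∷ ps) zero _ → p ; (p ∷ ps) (suc k) → from rest ps k }
  where rest = Flat⇔constraints A (B ∘ suc)
... | false = mk⇔ (λ f → to rest (f ∘ suc))
  λ { ps zero b → contradiction (trans (sym eq) b) λ () ; ps (suc k) → from rest ps k }
  where rest = Flat⇔constraints A (B ∘ suc)

record Solved {ℓ} (A : Arrangement ℓ) (B : SubArr A) : Set₁ where
  no-eta-equality
  field
    forest : Forest ℓ
    models : ∀ {D} → IsGain D → Flat D A B ⇔ D ⊨ forest

record Unsolved {ℓ} (A : Arrangement ℓ) (B : SubArr A) : Set₁ where
  no-eta-equality
  field
    gain      : ℤ
    gain≢0    : ¬ gain ≡ + 0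
    gain-loop : ∀ {D} → IsGain D → Flat D A B → ∃ λ i → D i i gain

open Solved
open Unsolved

solve-flat : ∀ {ℓ} (A : Arrangement ℓ) B → Solved A B ⊎ Unsolved A B
solve-flat A B with solve-constraints (constraints A B)
... | solvable F ok = inj₁ record { forest = F ; models = λ G →
  mk⇔ (to (ok G) ∘ to (Flat⇔constraints A B)) (from (Flat⇔constraints A B) ∘ from (ok G)) }
... | unsolvable n n≢0 bad = inj₂ record
  { gain = n ; gain≢0 = n≢0 ; gain-loop = λ G → bad G ∘ to (Flat⇔constraints A B) }

module Inclusion {ℓ} (A : Arrangement ℓ) where

  solved⇔ : ∀ {B} (s : Solved A B) x → flat A B x ⇔ Dℚ x ⊨ forest s
  solved⇔ {B} s x = mk⇔ (to (models s (isGainℚ x)) ∘ to (flat⇔Flat A B x))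
    (from (flat⇔Flat A B x) ∘ from (models s (isGainℚ x)))

  solved-nonempty : ∀ {B} → Solved A B → Nonempty (flat A B)
  solved-nonempty s = realize (forest s) (const 0ℚ) ,
    from (solved⇔ s (realize (forest s) (const 0ℚ))) (realize-⊨ (forest s) (const 0ℚ))

  unsolved-empty : ∀ {B} → Unsolved A B → ¬ Nonempty (flat A B)
  unsolved-empty {B} u (x , x∈) with gain-loop u (isGainℚ x) (to (flat⇔Flat A B x) x∈)
  ... | i , d = gain≢0 u (ℤ→ℚ-injective (trans (sym d) (IsGain.gain-refl (isGainℚ x) i)))

  FormalFlat : Forest ℓ → SubArr A → Set
  FormalFlat F B = ∀ k → B k ≡ true → Formal F (hom (lookup A k))

  formalFlat? : ∀ F B → Dec (FormalFlat F B)
  formalFlat? F B = Fin.all? λ k → (B k Bool.≟ true) →-dec formal? F (hom (lookup A k))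

  formalFlat-sound : ∀ F B {D} → FormalFlat F B → IsGain D → D ⊨ F → Flat D A B
  formalFlat-sound F B f G d k b = formal-sound G F d (hom (lookup A k)) (f k b)

  formalFlat-complete : ∀ F B → (∀ x → Dℚ x ⊨ F → flat A B x) → FormalFlat F B
  formalFlat-complete F B sub k b = formal-complete F (hom (lookup A k)) λ x d →
    to (flat⇔Flat A B x) (sub x d) k b

  ⊆ₛ⇔formalFlat : ∀ {B B′} (s : Solved A B) → FormalFlat (forest s) B′ ⇔ (flat A B ⊆ₛ flat A B′)
  ⊆ₛ⇔formalFlat {B} {B′} s = mk⇔
    (λ f x x∈ → from (flat⇔Flat A B′ x) (formalFlat-sound (forest s) B′ f (isGainℚ x) (to (solved⇔ s x) x∈)))
    (λ sub → formalFlat-complete (forest s) B′ λ x d → sub x (from (solved⇔ s x) d))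

  ⊆ₛ? : ∀ {B} → Solved A B → ∀ B′ → Dec (flat A B ⊆ₛ flat A B′)
  ⊆ₛ? s B′ = map′ (to (⊆ₛ⇔formalFlat s)) (from (⊆ₛ⇔formalFlat s)) (formalFlat? (forest s) B′)

  -- An inclusion over ℚ is formal, by completeness, and a formal inclusion holds for every gain
  -- relation. This carries the order of the intersection poset to ℤ/q.
  ⊆ₛ-transfer : ∀ {B B′ D} → Solved A B → flat A B ⊆ₛ flat A B′ → IsGain D → Flat D A B → Flat D A B′
  ⊆ₛ-transfer {B′ = B′} s sub G f = formalFlat-sound (forest s) B′ (from (⊆ₛ⇔formalFlat s) sub) G (to (models s G) f)

  -- Every point satisfies the discrete forest, so being the whole space is inclusion of the flat of
  -- that forest.
  whole⇔formalFlat : ∀ {B} → FormalFlat discrete B ⇔ IsWhole (flat A B)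
  whole⇔formalFlat {B} = mk⇔
    (λ f x → from (flat⇔Flat A B x) (formalFlat-sound discrete B f (isGainℚ x) (IsGain.gain-refl (isGainℚ x))))
    (λ w → formalFlat-complete discrete B λ x _ → w x)

  whole-flat? : ∀ B → Dec (IsWhole (flat A B))
  whole-flat? B = map′ (to whole⇔formalFlat) (from whole⇔formalFlat) (formalFlat? discrete B)

≐-sym : ∀ {ℓ} {S T : PSet ℓ} → S ≐ T → T ≐ S
≐-sym (a , b) = b , a

≐-trans : ∀ {ℓ} {S T U : PSet ℓ} → S ≐ T → T ≐ U → S ≐ U
≐-trans (a , b) (c , d) = (λ x → c x ∘ a x) , (λ x → b x ∘ d x)

-- An entry is kept unless a later kept entry is equivalent to it. The evidence `S x` is stored with
-- `x`, because the equivalence is decided from it: inclusion of flats is decided by means of their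
-- forests.
module Representatives {X : Set} {S : X → Set₁} {E : X → Set} {_~_ : X → X → Set}
  (~-refl : ∀ {x} → x ~ x) (solve : ∀ x → S x ⊎ (¬ E x))
  (~? : (w w′ : Σ X S) → Dec (proj₁ w ~ proj₁ w′)) where

  representatives : List X → List (Σ X S)
  representatives []       = []
  representatives (x ∷ xs) with solve x
  ... | inj₂ _ = representatives xs
  ... | inj₁ s with Any.any? (~? (x , s)) (representatives xs)
  ...   | yes _ = representatives xs
  ...   | no  _ = (x , s) ∷ representatives xs

  representatives-distinct : ∀ xs → AllPairs (λ w w′ → ¬ proj₁ w ~ proj₁ w′) (representatives xs)
  representatives-distinct []       = []
  representatives-distinct (x ∷ xs) with solve x
  ... | inj₂ _ = representatives-distinct xs
  ... | inj₁ s with Any.any? (~? (x , s)) (representatives xs)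
  ...   | yes _ = representatives-distinct xs
  ...   | no ∄  = All.¬Any⇒All¬ _ ∄ ∷ representatives-distinct xs

  representatives-cover : ∀ xs {x} → x ∈ xs → E x → Any (λ w → x ~ proj₁ w) (representatives xs)
  representatives-cover (x ∷ xs) x∈ e with solve x
  representatives-cover (x ∷ xs) (here refl) e | inj₂ ¬e = contradiction e ¬e
  representatives-cover (x ∷ xs) (there x∈)  e | inj₂ _  = representatives-cover xs x∈ e
  representatives-cover (x ∷ xs) x∈ e | inj₁ s with Any.any? (~? (x , s)) (representatives xs)
  representatives-cover (x ∷ xs) (here refl) e | inj₁ s | yes ∃w = ∃w
  representatives-cover (x ∷ xs) (there x∈)  e | inj₁ s | yes _  = representatives-cover xs x∈ e
  representatives-cover (x ∷ xs) (here refl) e | inj₁ s | no _   = here ~-refl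
  representatives-cover (x ∷ xs) (there x∈)  e | inj₁ s | no _   = there (representatives-cover xs x∈ e)

-- Well-founded recursion yields the value at `k′` only against a proof that `k′` is above `k`, so a
-- summand must receive the proof and not just a Boolean.
pick : ∀ {P : Set} → Dec P → (P → ℤ) → ℤ
pick (yes p) f = f p
pick (no _)  f = + 0

pick-cong : ∀ {P : Set} (d : Dec P) {f g : P → ℤ} → (∀ p → f p ≡ g p) → pick d f ≡ pick d g
pick-cong (yes p) eq = eq p
pick-cong (no _)  eq = refl

pick-const : ∀ {P : Set} (d : Dec P) z → pick d (const z) ≡ (if does d then z else + 0)
pick-const (yes _) z = refl
pick-const (no _)  z = refl

module Möbius {m} {_⊏_ : Fin m → Fin m → Set} {W : Fin m → Set} (above? : ∀ k k′ → Dec (k ⊏ k′))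
  (⊐-wellFounded : WellFounded (flip _⊏_)) (whole? : ∀ k → Dec (W k)) where

  step : ∀ k → WfRec (flip _⊏_) (const ℤ) k → ℤ
  step k rec = if does (whole? k) then + 1 else - sumℤ (λ k′ → pick (above? k k′) (λ p → rec p))

  step-ext : ∀ k {f g : WfRec (flip _⊏_) (const ℤ) k} → (∀ {k′} p → f {k′} p ≡ g p) → step k f ≡ step k g
  step-ext k eq = cong (λ z → if does (whole? k) then + 1 else - z)
    (sumℤ-cong λ k′ → pick-cong (above? k k′) λ p → eq p)

  μ : Fin m → ℤ
  μ = WF.wfRec ⊐-wellFounded _ (const ℤ) step

  Σ-above : Fin m → ℤ
  Σ-above k = sumℤ (λ k′ → if does (above? k k′) then μ k′ else + 0)

  μ-unfold : ∀ k → μ k ≡ (if does (whole? k) then + 1 else - Σ-above k)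
  μ-unfold k = trans (FixPoint.unfold-wfRec ⊐-wellFounded (const ℤ) step step-ext)
    (cong (λ z → if does (whole? k) then + 1 else - z)
      (sumℤ-cong λ k′ → pick-const (above? k k′) (μ k′)))

  μ-whole : ∀ k → W k → μ k ≡ + 1
  μ-whole k w = trans (μ-unfold k) (cong (λ b → if b then + 1 else - Σ-above k) (dec-true (whole? k) w))

  μ-rec : ∀ k → ¬ W k → μ k ≡ - Σ-above k
  μ-rec k ¬w = trans (μ-unfold k) (cong (λ b → if b then + 1 else - Σ-above k) (dec-false (whole? k) ¬w))

  module _ (k₀ : Fin m) (irrefl : ¬ k₀ ⊏ k₀) {P : Fin m → Set} (P? : ∀ k → Dec (P k))
    (P⇔ : ∀ k → P k ⇔ (k ≡ k₀ ⊎ k₀ ⊏ k)) where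

    split : ∀ k → (if does (P? k) then μ k else + 0) ≡
      (if does (k Fin.≟ k₀) then μ k else + 0) + (if does (above? k₀ k) then μ k else + 0)
    split k with P? k | k Fin.≟ k₀ | above? k₀ k
    ... | yes _ | yes refl | yes up = contradiction up irrefl
    ... | yes _ | yes refl | no _   = sym (ℤ.+-identityʳ (μ k))
    ... | yes _ | no _     | yes _  = sym (ℤ.+-identityˡ (μ k))
    ... | yes p | no ≢     | no ¬up = ⊥-elim (Sum.[ ≢ , ¬up ] (to (P⇔ k) p))
    ... | no ¬p | yes ≡k₀  | _      = contradiction (from (P⇔ k) (inj₁ ≡k₀)) ¬p
    ... | no ¬p | no _     | yes up = contradiction (from (P⇔ k) (inj₂ up)) ¬p
    ... | no _  | no _     | no _   = refl

    Σ-from : sumℤ (λ k → if does (P? k) then μ k else + 0) ≡ μ k₀ + Σ-above k₀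
    Σ-from = trans (sumℤ-cong split) (trans
      (sumℤ-+ (λ k → if does (k Fin.≟ k₀) then μ k else + 0) (λ k → if does (above? k₀ k) then μ k else + 0))
      (cong (_+ Σ-above k₀) (trans (sumℤ-single (λ k → if does (k Fin.≟ k₀) then μ k else + 0) k₀
        (λ k k≢k₀ → cong (λ b → if b then μ k else + 0) (dec-false (k Fin.≟ k₀) k≢k₀)))
        (cong (λ b → if b then μ k₀ else + 0) (dec-true (k₀ Fin.≟ k₀) refl)))))

    -- Once μ k₀ is split off, the rest is the sum over all flats strictly above. The recursion
    -- makes the two cancel, except at the whole space, where nothing lies above and μ k₀ = 1
    -- remains.
    Σ-indicator : (W k₀ → ∀ k → ¬ k₀ ⊏ k) → ∀ {Q : Set} (Q? : Dec Q) → Q ⇔ W k₀ →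
      sumℤ (λ k → if does (P? k) then μ k else + 0) ≡ (if does Q? then + 1 else + 0)
    Σ-indicator top (yes q) Q⇔W = trans Σ-from (cong₂ _+_ (μ-whole k₀ (to Q⇔W q))
      (sumℤ-zero λ k → cong (λ b → if b then μ k else + 0) (dec-false (above? k₀ k) (top (to Q⇔W q) k))))
    Σ-indicator top (no ¬q) Q⇔W = trans Σ-from
      (trans (cong (_+ Σ-above k₀) (μ-rec k₀ (¬q ∘ from Q⇔W))) (ℤ.+-inverseˡ (Σ-above k₀)))

module Flats {ℓ} (A : Arrangement ℓ) where
  open Inclusion A

  -- Subarrangements are functions and cannot be listed up to propositional equality; Boolean
  -- vectors can, and `tabulate-≐` leads back to functions.
  Code : Set
  Code = Vec Bool (length A)

  SolvedCode : Set₁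
  SolvedCode = Σ Code (Solved A ∘ Vec.lookup)

  ⟦_⟧ : SolvedCode → PSet ℓ
  ⟦ w ⟧ = flat A (Vec.lookup (proj₁ w))

  ≐? : ∀ (w w′ : SolvedCode) → Dec (⟦ w ⟧ ≐ ⟦ w′ ⟧)
  ≐? w w′ = ⊆ₛ? (proj₂ w) (Vec.lookup (proj₁ w′)) ×-dec ⊆ₛ? (proj₂ w′) (Vec.lookup (proj₁ w))

  solve-code : ∀ v → Solved A (Vec.lookup v) ⊎ (¬ Nonempty (flat A (Vec.lookup v)))
  solve-code v = Sum.map₂ unsolved-empty (solve-flat A (Vec.lookup v))

  open Representatives {E = λ v → Nonempty (flat A (Vec.lookup v))}
    {_~_ = λ v v′ → flat A (Vec.lookup v) ≐ flat A (Vec.lookup v′)}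
    ((λ _ p → p) , (λ _ p → p)) solve-code ≐?

  codes : List Code
  codes = vecs (true ∷ false ∷ []) (length A)

  ∈-codes : ∀ v → v ∈ codes
  ∈-codes = ∈-vecs λ { true → here refl ; false → there (here refl) }

  m : ℕ
  m = length (representatives codes)

  solvedRep : Fin m → SolvedCode
  solvedRep = lookup (representatives codes)

  rep : Fin m → SubArr A
  rep = Vec.lookup ∘ proj₁ ∘ solvedRep

  X : Fin m → PSet ℓ
  X = flat A ∘ rep

  sol : ∀ k → Solved A (rep k)
  sol = proj₂ ∘ solvedRep

  rep-inj : ∀ k k′ → X k ≐ X k′ → k ≡ k′
  rep-inj k k′ eq = decidable-stable (k Fin.≟ k′) λ k≢k′ →
    AllPairs-lookup (_∘ ≐-sym) (representatives-distinct codes) k k′ k≢k′ eq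

  code-cover : ∀ v → Nonempty (flat A (Vec.lookup v)) → Σ (Fin m) λ k → flat A (Vec.lookup v) ≐ X k
  code-cover v ne = Any.index found , Any.lookup-index found
    where found = representatives-cover codes (∈-codes v) ne

  tabulate-≐ : ∀ B → flat A B ≐ flat A (Vec.lookup (Vec.tabulate B))
  tabulate-≐ B = (λ x f k b → f k (trans (sym (Vec.lookup∘tabulate B k)) b))
               , (λ x f k b → f k (trans (Vec.lookup∘tabulate B k) b))

  rep-cover : ∀ B → Nonempty (flat A B) → Σ (Fin m) λ k → flat A B ≐ X k
  rep-cover B (x , x∈) = let (k , eq) = code-cover (Vec.tabulate B) (x , proj₁ (tabulate-≐ B) x x∈) in
    k , ≐-trans (tabulate-≐ B) eq

  dim : Fin m → ℕ
  dim k = rank (forest (sol k))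

  above? : ∀ k k′ → Dec (X k ⊂ₛ X k′)
  above? k k′ = ⊆ₛ? (sol k) (rep k′) ×-dec ¬? (⊆ₛ? (sol k′) (rep k))

  ⊂-isStrictPartialOrder : IsStrictPartialOrder _≡_ (λ k k′ → X k ⊂ₛ X k′)
  ⊂-isStrictPartialOrder = record
    { isEquivalence = isEquivalence
    ; irrefl        = λ { refl (a , b) → b a }
    ; trans         = λ { (a , b) (c , d) → (λ x → c x ∘ a x) , λ e → d (λ x → a x ∘ e x) }
    ; <-resp-≈      = resp₂ _ }

  ⊃-wellFounded : WellFounded (λ k′ k → X k ⊂ₛ X k′)
  ⊃-wellFounded = spo-noetherian ⊂-isStrictPartialOrder

  open Möbius {W = IsWhole ∘ X} above? ⊃-wellFounded (whole-flat? ∘ rep) public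

  χ : ℕ → ℤ
  χ d = sumℤ (λ k → if dim k ℕ.≡ᵇ d then μ k else + 0)

  χ-isCharPoly : IsCharPoly A χ
  χ-isCharPoly = record
    { m = m ; rep = rep ; rep-ne = solved-nonempty ∘ sol ; rep-inj = rep-inj ; rep-cover = rep-cover
    ; dim = dim ; dim-ok = λ k → isDim-forest (forest (sol k)) (X k) (solved⇔ (sol k))
    ; whole? = whole-flat? ∘ rep ; above? = above?
    ; μ = μ ; μ-whole = μ-whole ; μ-rec = μ-rec ; coeff = λ _ → refl }

  χ-degree : ∀ d → ℓ ℕ.< d → χ d ≡ + 0
  χ-degree d ℓ<d = sumℤ-zero λ k → cong (λ b → if b then μ k else + 0)
    (dec-false (dim k ℕ.≟ d) λ eq → ℕ.<⇒≱ ℓ<d (subst (ℕ._≤ ℓ) eq (rank≤ (forest (sol k)))))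

  horner-χ : ∀ q → horner (suc ℓ) χ (+ q) ≡ sumℤ (λ k → μ k * + (q ℕ.^ dim k))
  horner-χ q = trans (horner-sumℤ (suc ℓ) (λ k d → if dim k ℕ.≡ᵇ d then μ k else + 0) (+ q))
    (sumℤ-cong λ k → horner-monomial (μ k) q (ℕ.s≤s (rank≤ (forest (sol k)))))

-- Points modulo q off an arrangement

satMod? : ∀ {ℓ} q (x : Fin ℓ → ℤ) h → Dec (Sat (Dmod q x) h)
satMod? q x (i , j , c) = Dmod? q x i j c

Avoids : ∀ {ℓ} → ℕ → Arrangement ℓ → (Fin ℓ → ℤ) → Set
Avoids q A x = All (λ h → ¬ Sat (Dmod q x) (hom h)) A

avoids? : ∀ {ℓ} q (A : Arrangement ℓ) (x : Vec (Fin q) ℓ) → Dec (Avoids q A (val x))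
avoids? q A x = All.all? (λ h → ¬? (satMod? q (val x) (hom h))) A

does≡true⇒ : ∀ {P : Set} (d : Dec P) → does d ≡ true → P
does≡true⇒ (yes p) _ = p

-- Excludes x i - x i = c, which for c = 0 is no hyperplane but the whole space. For a proper
-- hyperplane, lying on it prevents the smallest flat from being the whole space.
Proper : ∀ {ℓ} → Hyp ℓ → Set
Proper h = ¬ proj₁ (hom h) ≡ proj₁ (proj₂ (hom h))

module FiniteField {ℓ} (A : Arrangement ℓ) (proper : All Proper A) where
  open Flats A
  open Inclusion A

  -- The modulus must exceed every |n| for which some set of hyperplanes implies n = 0; then points
  -- modulo q lie only on sets of hyperplanes that also intersect over ℚ.
  obstruction : ∀ {B} → Solved A B ⊎ Unsolved A B → ℕ
  obstruction (inj₁ _) = 0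
  obstruction (inj₂ u) = ∣ gain u ∣

  obstructions : List Code → ℕ
  obstructions vs = ℕ.sum (map (λ v → obstruction (solve-flat A (Vec.lookup v))) vs)

  obstruction≤ : ∀ {v vs} → v ∈ vs → obstruction (solve-flat A (Vec.lookup v)) ℕ.≤ obstructions vs
  obstruction≤ (here refl) = ℕ.m≤m+n _ _
  obstruction≤ (there v∈)  = ℕ.≤-trans (obstruction≤ v∈) (ℕ.m≤n+m _ _)

  solved-large : ∀ {q D} v → obstructions codes ℕ.< q → IsGain D → (∀ i n → D i i n → + q ∣ n) →
    Flat D A (Vec.lookup v) → Solved A (Vec.lookup v)
  solved-large v large G loop f with solve-flat A (Vec.lookup v) | obstruction≤ (∈-codes v)
  ... | inj₁ s | _  = s
  ... | inj₂ u | n≤ = contradiction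
    (n<m∣k⇒k≡0 (ℕ.≤-<-trans n≤ large) (loop _ _ (proj₂ (gain-loop u G f)))) (gain≢0 u)

  module _ (q : ℕ) (large : obstructions codes ℕ.< q) (x : Vec (Fin q) ℓ) where

    D : GainRel (suc ℓ)
    D = Dmod q (val x)

    G : IsGain D
    G = isGainMod q (val x)

    loop : ∀ i n → D i i n → + q ∣ n
    loop i n d = ∣-resp (lem ((+ 0 Vector.∷ val x) i) n) (∣ℤ.∣m⇒∣-m d)
      where
      lem : ∀ a n → - ((a - a) - n) ≡ n
      lem = solve-∀

    on? : ∀ h → Dec (Sat D (hom h))
    on? h = satMod? q (val x) (hom h)

    -- All hyperplanes that contain `x` modulo q. Their intersection over ℚ is the smallest flat on
    -- which `x` lies, from which the Möbius sum starts.
    through : Code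
    through = Vec.tabulate λ h → does (on? (lookup A h))

    through⇔ : ∀ h → Vec.lookup through h ≡ true ⇔ Sat D (hom (lookup A h))
    through⇔ h = mk⇔
      (λ b → does≡true⇒ (on? (lookup A h)) (trans (sym (Vec.lookup∘tabulate (λ h → does (on? (lookup A h))) h)) b))
      (λ s → trans (Vec.lookup∘tabulate (λ h → does (on? (lookup A h))) h) (dec-true (on? (lookup A h)) s))

    on-through : Flat D A (Vec.lookup through)
    on-through h = to (through⇔ h)

    solved-through : Solved A (Vec.lookup through)
    solved-through = solved-large through large G loop on-through

    module _ (k₀ : Fin m) (X₀≐ : flat A (Vec.lookup through) ≐ X k₀) where

      -- If `x` lies on the flat `k`, then the hyperplanes that define this flat are among those
      -- through `x`. The converse transfers the inclusion over ℚ to ℤ/q.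
      ⊨⇔⊆ : ∀ k → D ⊨ forest (sol k) ⇔ (X k₀ ⊆ₛ X k)
      ⊨⇔⊆ k = mk⇔
        (λ d y y∈ h b → proj₂ X₀≐ y y∈ h (from (through⇔ h) (from (models (sol k) G) d h b)))
        (λ sub → to (models (sol k) G)
          (⊆ₛ-transfer solved-through (λ y → sub y ∘ proj₁ X₀≐ y) G on-through))

      avoids⇔whole : Avoids q A (val x) ⇔ IsWhole (X k₀)
      avoids⇔whole = mk⇔
        (λ av y → proj₁ X₀≐ y λ h b →
          contradiction (to (through⇔ h) b) (All.lookup av (∈-lookup h)))
        (λ w → All.tabulate λ h∈ s → All.lookup proper h∈ (proper-free w h∈ s))
        where
        proper-free : IsWhole (X k₀) → ∀ {h} → (h∈ : h ∈ A) → Sat D (hom h) →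
          proj₁ (hom h) ≡ proj₁ (proj₂ (hom h))
        proper-free w h∈ s = subst (λ h → proj₁ (hom h) ≡ proj₁ (proj₂ (hom h))) (sym (Any.lookup-index h∈))
          (proj₁ (from whole⇔formalFlat (λ y → proj₂ X₀≐ y (w y)) (Any.index h∈)
            (from (through⇔ (Any.index h∈)) (subst (Sat D ∘ hom) (Any.lookup-index h∈) s))))

      ⊨⇔above : ∀ k → D ⊨ forest (sol k) ⇔ (k ≡ k₀ ⊎ X k₀ ⊂ₛ X k)
      ⊨⇔above k = mk⇔
        (λ d → Sum.map₂ (λ k≢k₀ → to (⊨⇔⊆ k) d , λ sub → k≢k₀ (rep-inj k k₀ (sub , to (⊨⇔⊆ k) d))) (toSum (k Fin.≟ k₀)))
        λ { (inj₁ refl) → from (⊨⇔⊆ k) (λ _ p → p) ; (inj₂ up) → from (⊨⇔⊆ k) (proj₁ up) }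

    Σ-on≡avoids : sumℤ (λ k → if does (⊨mod? q (forest (sol k)) x) then μ k else + 0) ≡
      (if does (avoids? q A x) then + 1 else + 0)
    Σ-on≡avoids = let (k₀ , X₀≐) = code-cover through (solved-nonempty solved-through) in
      Σ-indicator k₀ (λ (a , b) → b a) (λ k → ⊨mod? q (forest (sol k)) x) (⊨⇔above k₀ X₀≐)
        (λ w k (_ , ¬sub) → ¬sub (λ y _ → w y)) (avoids? q A x) (avoids⇔whole k₀ X₀≐)

  χ-count : ∀ q → obstructions codes ℕ.< q →
    horner (suc ℓ) χ (+ q) ≡ + count (avoids? q A) (points q ℓ)
  χ-count q@(suc _) large = trans (horner-χ q) (trans
    (sumℤ-cong λ k → cong (λ n → μ k * + n) (sym (count-flat (forest (sol k)) q)))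
    (sumℤ-count μ (λ k → ⊨mod? q (forest (sol k))) (avoids? q A) (Σ-on≡avoids q large) (points q ℓ)))

counts-determine : ∀ n (p p′ : ℕ → ℤ) (f f′ : ℕ → ℕ) {N N′} →
  (∀ d → n ℕ.≤ d → p d ≡ + 0) → (∀ d → n ℕ.≤ d → p′ d ≡ + 0) →
  (∀ q → N ℕ.< q → horner n p (+ q) ≡ + f q) → (∀ q → N′ ℕ.< q → horner n p′ (+ q) ≡ + f′ q) →
  (∀ q → .{{ℕ.NonZero q}} → f q ≡ f′ q) → ∀ d → p d ≡ p′ d
counts-determine n p p′ f f′ {N} {N′} deg deg′ ev ev′ eq d with d ℕ.<? n
... | no d≮n  = trans (deg d (ℕ.≮⇒≥ d≮n)) (sym (deg′ d (ℕ.≮⇒≥ d≮n)))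
... | yes d<n = horner-unique n p p′ (N ℕ.+ N′) agree d d<n
  where
  agree : ∀ q → N ℕ.+ N′ ℕ.< q → horner n p (+ q) ≡ horner n p′ (+ q)
  agree q@(suc _) N<q = trans (ev q (ℕ.≤-<-trans (ℕ.m≤m+n N N′) N<q))
    (trans (cong +_ (eq q)) (sym (ev′ q (ℕ.≤-<-trans (ℕ.m≤n+m N′ N) N<q))))

-- Only the field `coeff` mentions the polynomial, so pointwise equality of coefficients can stand
-- in for equality of functions.
IsCharPoly-resp : ∀ {ℓ} {A : Arrangement ℓ} {p p′} → (∀ d → p d ≡ p′ d) → IsCharPoly A p → IsCharPoly A p′
IsCharPoly-resp eq C = record
  { IsCharPoly C hiding (coeff) ; coeff = λ d → trans (sym (eq d)) (IsCharPoly.coeff C d) }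

common-charPoly : ∀ {ℓ} (A A′ : Arrangement ℓ) → All Proper A → All Proper A′ →
  (∀ q → .{{ℕ.NonZero q}} → count (avoids? q A) (points q ℓ) ≡ count (avoids? q A′) (points q ℓ)) →
  Σ (ℕ → ℤ) λ p → IsCharPoly A p × IsCharPoly A′ p
common-charPoly {ℓ} A A′ proper proper′ eq =
  Flats.χ A , Flats.χ-isCharPoly A , IsCharPoly-resp (sym ∘ χ≡χ′) (Flats.χ-isCharPoly A′)
  where
  open FiniteField
  χ≡χ′ : ∀ d → Flats.χ A d ≡ Flats.χ A′ d
  χ≡χ′ = counts-determine (suc ℓ) (Flats.χ A) (Flats.χ A′)
    (λ q → count (avoids? q A) (points q ℓ)) (λ q → count (avoids? q A′) (points q ℓ))
    (Flats.χ-degree A) (Flats.χ-degree A′) (χ-count A proper) (χ-count A′ proper′) eq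

-- ψ-digraphical arrangements modulo q

module _ {A B : Set} {P : B → Set} {f : A → List B} where

  All-concatMap⁺ : ∀ xs → (∀ x → All P (f x)) → All P (concatMap f xs)
  All-concatMap⁺ xs p = All.concat⁺ (All.map⁺ (All.universal p xs))

  All-concatMap⁻ : ∀ {xs x} → x ∈ xs → All P (concatMap f xs) → All P (f x)
  All-concatMap⁻ x∈ p = All.lookup (All.map⁻ (All.concat⁻ p)) x∈

∈-allPairs : ∀ {ℓ} (i j : Fin ℓ) → (i , j) ∈ allPairs ℓ
∈-allPairs i j = ∈-concatMap⁺ _ (Any.map (λ { refl → ∈-map⁺ _ (∈-allFin j) }) (∈-allFin i))

All-if⁺ : ∀ {A : Set} {P : A → Set} b {x} → (b ≡ true → P x) → All P (if b then x ∷ [] else [])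
All-if⁺ true  p = p refl ∷ []
All-if⁺ false p = []

All-if⁻ : ∀ {A : Set} {P : A → Set} b {x} → b ≡ true → All P (if b then x ∷ [] else []) → P x
All-if⁻ true _ (p ∷ []) = p

-- An inequality depends only on the difference of its sides. Linear consequences are thus reduced
-- to a ring identity between two differences, which the solver proves.
<-shift : ∀ {u w u′ w′} → u < w → w - u ≡ w′ - u′ → u′ < w′
<-shift {u} {w} {u′} {w′} u<w eq = subst₂ _<_ (lem u u′)
  (trans (lem₂ w u u′) (trans (cong (_+ u′) eq) (lem₃ w′ u′))) (ℤ.+-monoˡ-< (u′ - u) u<w)
  where
  lem : ∀ u u′ → u + (u′ - u) ≡ u′
  lem = solve-∀
  lem₂ : ∀ w u u′ → w + (u′ - u) ≡ (w - u) + u′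
  lem₂ = solve-∀
  lem₃ : ∀ w u → (w - u) + u ≡ w
  lem₃ = solve-∀

≤-shift : ∀ {u w u′ w′} → u ≤ w → w - u ≡ w′ - u′ → u′ ≤ w′
≤-shift {u} {w} {u′} {w′} u≤w eq = ℤ.0≤i-j⇒j≤i (subst (+ 0 ≤_) eq (ℤ.i≤j⇒0≤j-i u≤w))

≤-suc : ∀ {u w} → u < w → u + + 1 ≤ w
≤-suc {u} u<w = subst (_≤ _) (ℤ.+-comm (+ 1) u) (ℤ.i<j⇒suc[i]≤j u<w)

suc-≤ : ∀ {u w} → u + + 1 ≤ w → u < w
suc-≤ {u} u≤w = ℤ.suc[i]≤j⇒i<j (subst (_≤ _) (ℤ.+-comm u (+ 1)) u≤w)

abs-< : ∀ {k : ℤ} {q : ℕ} → - + q < k → k < + q → ∣ k ∣ ℕ.< q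
abs-< {+ n}       _         (+<+ n<q) = n<q
abs-< {k = -[1+ n ]} {suc q} (-<- n<q) _ = ℕ.s≤s n<q

module _ {Q : ℤ → Set} where

  upFrom⁺ : ∀ a n → (∀ k → k ℕ.< n → Q (a + + k)) → All Q (upFrom a n)
  upFrom⁺ a zero    p = []
  upFrom⁺ a (suc n) p = subst Q (ℤ.+-identityʳ a) (p 0 (ℕ.s≤s ℕ.z≤n)) ∷
    upFrom⁺ (a + + 1) n λ k k<n → subst Q (sym (ℤ.+-assoc a (+ 1) (+ k))) (p (suc k) (ℕ.s≤s k<n))

  upFrom⁻ : ∀ a n → All Q (upFrom a n) → ∀ k → k ℕ.< n → Q (a + + k)
  upFrom⁻ a (suc n) (p ∷ ps) zero    _           = subst Q (sym (ℤ.+-identityʳ a)) p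
  upFrom⁻ a (suc n) (p ∷ ps) (suc k) (ℕ.s≤s k<n) =
    subst Q (ℤ.+-assoc a (+ 1) (+ k)) (upFrom⁻ (a + + 1) n ps k k<n)

  module _ {a b : ℤ} (a≤b : a ≤ b) where

    interval≡ : interval a b ≡ upFrom a (suc ∣ b - a ∣)
    interval≡ = cong (λ c → if c then upFrom a (suc ∣ b - a ∣) else [])
      (to Bool.T-≡ (ℤ.≤⇒≤ᵇ a≤b))

    length≡ : + ∣ b - a ∣ ≡ b - a
    length≡ = ℤ.0≤i⇒+∣i∣≡i (ℤ.i≤j⇒0≤j-i a≤b)

    interval⁺ : (∀ c → a ≤ c → c ≤ b → Q c) → All Q (interval a b)
    interval⁺ p = subst (All Q) (sym interval≡) (upFrom⁺ a _ λ k k<n →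
      p (a + + k) (ℤ.i≤i+j a (+ k)) (≤-shift (subst (+ k ≤_) length≡ (+≤+ (ℕ.≤-pred k<n))) (lem a b (+ k))))
      where
      lem : ∀ a b k → (b - a) - k ≡ b - (a + k)
      lem = solve-∀

    interval⁻ : All Q (interval a b) → ∀ c → a ≤ c → c ≤ b → Q c
    interval⁻ p c a≤c c≤b = subst Q (trans (cong (λ k → a + k) k≡) (lem a c))
      (upFrom⁻ a _ (subst (All Q) interval≡ p) ∣ c - a ∣
        (ℕ.s≤s (ℤ.drop‿+≤+ (subst₂ _≤_ (sym k≡) (sym length≡) (≤-shift c≤b (lem₂ a b c))))))
      where
      k≡ : + ∣ c - a ∣ ≡ c - a
      k≡ = ℤ.0≤i⇒+∣i∣≡i (ℤ.i≤j⇒0≤j-i a≤c)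
      lem : ∀ a c → a + (c - a) ≡ c
      lem = solve-∀
      lem₂ : ∀ a b c → b - c ≡ (b - a) - (c - a)
      lem₂ = solve-∀

module _ {ℓ} {E : Digraph ℓ} {a b : Fin ℓ → ℤ} (a≤b : ∀ i → a i ≤ b i) {P : Hyp ℓ → Set} where

  psiArr⁺ : (∀ i j → toℕ i ℕ.< toℕ j → P (diffH i j (+ 0))) → (∀ i j → E i j ≡ true → P (diffH i j (+ 1))) →
    (∀ i c → a i ≤ c → c ≤ b i → P (coordH i c)) → All P (psiArr E a b)
  psiArr⁺ p₀ p₁ p₂ = All.++⁺
    (All-concatMap⁺ (allPairs ℓ) λ (i , j) → All-if⁺ _ λ eq → p₀ i j (ℕ.<ᵇ⇒< _ _ (from Bool.T-≡ eq)))
    (All.++⁺ (All-concatMap⁺ (allPairs ℓ) λ (i , j) → All-if⁺ (E i j) (p₁ i j))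
      (All-concatMap⁺ (allFin ℓ) λ i → All.map⁺ (interval⁺ (a≤b i) (p₂ i))))

  module _ (p : All P (psiArr E a b)) where

    psiArr⁻-diff₀ : ∀ i j → toℕ i ℕ.< toℕ j → P (diffH i j (+ 0))
    psiArr⁻-diff₀ i j i<j = All-if⁻ _ (to Bool.T-≡ (ℕ.<⇒<ᵇ i<j))
      (All-concatMap⁻ (∈-allPairs i j) (All.++⁻ˡ _ p))

    psiArr⁻-diff₁ : ∀ i j → E i j ≡ true → P (diffH i j (+ 1))
    psiArr⁻-diff₁ i j e = All-if⁻ (E i j) e
      (All-concatMap⁻ (∈-allPairs i j) (All.++⁻ˡ _ (All.++⁻ʳ (concatMap _ (allPairs ℓ)) p)))

    psiArr⁻-coord : ∀ i c → a i ≤ c → c ≤ b i → P (coordH i c)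
    psiArr⁻-coord i = interval⁻ (a≤b i) (All.map⁻
      (All-concatMap⁻ (∈-allFin i) (All.++⁻ʳ (concatMap _ (allPairs ℓ)) (All.++⁻ʳ (concatMap _ (allPairs ℓ)) p))))

record Admissible {ℓ} (q : ℕ) (E : Digraph ℓ) (a b x : Fin ℓ → ℤ) : Set where
  field
    distinct : ∀ i j → ¬ i ≡ j → ¬ x i ≡ x j
    edge     : ∀ i j → E i j ≡ true → ¬ x i ≡ x j + + 1
    lower    : ∀ i → b i < x i
    upper    : ∀ i → x i < + q + a i

open Admissible

ContainsZero : ∀ {ℓ} → (a b : Fin ℓ → ℤ) → Set
ContainsZero a b = ∀ i → (a i ≤ + 0) × (+ 0 ≤ b i)

module _ {ℓ} {q : ℕ} {E : Digraph ℓ} {a b : Fin ℓ → ℤ} (0∈ : ContainsZero a b) where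

  zero∈⇒≤ : ∀ i → a i ≤ b i
  zero∈⇒≤ i = ℤ.≤-trans (proj₁ (0∈ i)) (proj₂ (0∈ i))

  admissible-pos : ∀ {x} → Admissible q E a b x → ∀ i → + 0 < x i
  admissible-pos adm i = ℤ.≤-<-trans (proj₂ (0∈ i)) (lower adm i)

  admissible-< : ∀ {x} → Admissible q E a b x → ∀ i → x i < + q
  admissible-< adm i = ℤ.<-≤-trans (upper adm i)
    (subst (+ q + a i ≤_) (ℤ.+-identityʳ (+ q)) (ℤ.+-monoʳ-≤ (+ q) (proj₁ (0∈ i))))

  -- All relevant differences lie strictly between -q and q, so divisibility by q makes them 0.
  -- Positivity of the coordinates, which comes from 0 ∈ ψ(i), excludes the wrap-around x i = 0, x j
  -- = q - 1, where x i is x j + 1 modulo q but not as an integer.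
  admissible⇒avoids : (x : Vec (Fin q) ℓ) → Admissible q E a b (val x) → Avoids q (psiArr E a b) (val x)
  admissible⇒avoids x adm = psiArr⁺ zero∈⇒≤
    (λ i j i<j d → distinct adm i j (λ { refl → ℕ.<-irrefl refl i<j })
      (cong (λ k → + toℕ k) (congruent⇒≡ _ _ (∣-resp (ℤ.+-identityʳ _) d))))
    (λ i j e d → edge adm i j e (ℤ.i-j≡0⇒i≡j _ _ (trans (lem₁ (val x i) (val x j))
      (n<m∣k⇒k≡0 (abs-< (above i j) (below i j)) d))))
    (λ i c a≤c c≤b d → ℤ.<-irrefl (sym (ℤ.i-j≡0⇒i≡j (val x i) c (trans (lem₂ (val x i) c)
      (n<m∣k⇒k≡0 (abs-< (ℤ.≤-<-trans (ℤ.neg-≤-pos {q} {0}) (positive i c c≤b)) (small i c a≤c)) d))))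
      (ℤ.≤-<-trans c≤b (lower adm i)))
    where
    lem₁ : ∀ x y → x - (y + + 1) ≡ (x - y) - + 1
    lem₁ = solve-∀
    lem₂ : ∀ x c → x - c ≡ (x - + 0) - c
    lem₂ = solve-∀
    above : ∀ i j → - + q < (val x i - val x j) - + 1
    above i j = <-shift
      (ℤ.+-mono-≤-< (≤-suc (admissible-pos adm i)) (admissible-< adm j)) (lem (val x i) (val x j) (+ q))
      where
      lem : ∀ x y q → (x + q) - ((+ 0 + + 1) + y) ≡ ((x - y) - + 1) - - q
      lem = solve-∀
    below : ∀ i j → (val x i - val x j) - + 1 < + q
    below i j = <-shift (ℤ.+-mono-<-≤ (admissible-< adm i)
      (ℤ.≤-trans (ℤ.<⇒≤ (admissible-pos adm j)) (ℤ.i≤i+j (val x j) (+ 1)))) (lem (val x i) (val x j) (+ q))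
      where
      lem : ∀ x y q → (q + (y + + 1)) - (x + + 0) ≡ q - ((x - y) - + 1)
      lem = solve-∀
    positive : ∀ i c → c ≤ b i → + 0 < (val x i - + 0) - c
    positive i c c≤b = <-shift (ℤ.≤-<-trans c≤b (lower adm i)) (lem (val x i) c)
      where
      lem : ∀ x c → x - c ≡ ((x - + 0) - c) - + 0
      lem = solve-∀
    small : ∀ i c → a i ≤ c → (val x i - + 0) - c < + q
    small i c a≤c = <-shift (ℤ.<-≤-trans (upper adm i) (ℤ.+-monoʳ-≤ (+ q) a≤c)) (lem (val x i) c (+ q))
      where
      lem : ∀ x c q → (q + c) - x ≡ q - ((x - + 0) - c)
      lem = solve-∀

  avoids⇒admissible : (x : Vec (Fin q) ℓ) → Avoids q (psiArr E a b) (val x) → Admissible q E a b (val x)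
  avoids⇒admissible x av = record
    { distinct = dist
    ; edge     = λ i j e eq → psiArr⁻-diff₁ zero∈⇒≤ av i j e
        (divides (+ 0) (trans (cong (λ z → (z - val x j) - + 1) eq) (lem (val x j))))
    ; lower    = λ i → ℤ.≰⇒> λ x≤b → psiArr⁻-coord zero∈⇒≤ av i (val x i) (ℤ.≤-trans (proj₁ (0∈ i)) (+≤+ ℕ.z≤n)) x≤b
        (divides (+ 0) (lem₂ (val x i)))
    -- The negative part of ψ(i) occupies the residues at the top: if q + a i ≤ x i, then x i - q
    -- lies in ψ(i) and is congruent to x i.
    ; upper    = λ i → ℤ.≰⇒> λ q+a≤x → psiArr⁻-coord zero∈⇒≤ av i (val x i - + q)
        (≤-shift q+a≤x (lem₃ (val x i) (a i) (+ q)))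
        (ℤ.≤-trans (ℤ.<⇒≤ (<-shift (+<+ (Fin.toℕ<n (Vec.lookup x i))) (lem₄ (val x i) (+ q)))) (proj₂ (0∈ i)))
        (divides (+ 1) (lem₅ (val x i) (+ q))) }
    where
    lem : ∀ y → ((y + + 1) - y) - + 1 ≡ + 0
    lem = solve-∀
    lem₂ : ∀ y → (y - + 0) - y ≡ + 0
    lem₂ = solve-∀
    lem₃ : ∀ x a q → x - (q + a) ≡ (x - q) - a
    lem₃ = solve-∀
    lem₄ : ∀ x q → q - x ≡ + 0 - (x - q)
    lem₄ = solve-∀
    lem₅ : ∀ x q → (x - + 0) - (x - q) ≡ + 1 * q
    lem₅ = solve-∀
    apart : ∀ i j → toℕ i ℕ.< toℕ j → ¬ val x i ≡ val x j
    apart i j i<j eq = psiArr⁻-diff₀ zero∈⇒≤ av i j i<j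
      (divides (+ 0) (trans (ℤ.+-identityʳ _) (ℤ.i≡j⇒i-j≡0 eq)))
    dist : ∀ i j → ¬ i ≡ j → ¬ val x i ≡ val x j
    dist i j i≢j eq with ℕ.<-cmp (toℕ i) (toℕ j)
    ... | tri< i<j _ _ = apart i j i<j eq
    ... | tri≈ _ i≡j _ = i≢j (Fin.toℕ-injective i≡j)
    ... | tri> _ _ j<i = apart j i j<i (sym eq)

Admissible-resp : ∀ {ℓ q} {E : Digraph ℓ} {a a′ b b′ x x′ : Fin ℓ → ℤ} →
  (∀ i → a i ≡ a′ i) → (∀ i → b i ≡ b′ i) → (∀ i → x i ≡ x′ i) →
  Admissible q E a b x → Admissible q E a′ b′ x′
Admissible-resp {q = q} a≡ b≡ x≡ adm = record
  { distinct = λ i j i≢j eq → distinct adm i j i≢j (trans (x≡ i) (trans eq (sym (x≡ j))))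
  ; edge     = λ i j e eq → edge adm i j e (trans (x≡ i) (trans eq (cong (_+ + 1) (sym (x≡ j)))))
  ; lower    = λ i → subst₂ _<_ (b≡ i) (x≡ i) (lower adm i)
  ; upper    = λ i → subst₂ (λ x a → x < + q + a) (x≡ i) (a≡ i) (upper adm i) }

residue-small : ∀ q .{{_ : ℕ.NonZero q}} z → + 0 ≤ z → z < + q → + toℕ (residue q z) ≡ z
residue-small q (+ n) _ (+<+ n<q) = trans
  (cong (λ k → + toℕ k) (congruent⇒≡ (residue q (+ n)) (fromℕ< n<q)
    (subst (λ m → + q ∣ + toℕ (residue q (+ n)) - + m) (sym (Fin.toℕ-fromℕ< n<q)) (residue-∣ q (+ n)))))
  (cong +_ (Fin.toℕ-fromℕ< n<q))

avoiding : ∀ {ℓ} → ℕ → Digraph ℓ → (a b : Fin ℓ → ℤ) → ℕ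
avoiding {ℓ} q E a b = count (avoids? q (psiArr E a b)) (points q ℓ)

module _ {ℓ} {q : ℕ} .{{_ : ℕ.NonZero q}} {E E′ : Digraph ℓ} {a b a′ b′ : Fin ℓ → ℤ}
  (0∈ : ContainsZero a b) (0∈′ : ContainsZero a′ b′) where

  -- The map on residues reduces the integer point `f x` modulo q. This changes nothing, since an
  -- admissible point has coordinates between 0 and q, so the left inverse `g` still yields
  -- injectivity; `g-cong` replaces function extensionality.
  avoiding-≤ : (f g : (Fin ℓ → ℤ) → Fin ℓ → ℤ) →
    (∀ x → Admissible q E a b x → Admissible q E′ a′ b′ (f x)) →
    (∀ x → Admissible q E a b x → ∀ i → g (f x) i ≡ x i) →
    (∀ x y → (∀ i → x i ≡ y i) → ∀ i → g x i ≡ g y i) →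
    avoiding q E a b ℕ.≤ avoiding q E′ a′ b′
  avoiding-≤ f g pres inv g-cong = count-≤ (avoids? q (psiArr E a b)) (avoids? q (psiArr E′ a′ b′)) φ
    (λ x av → admissible⇒avoids 0∈′ (φ x) (Admissible-resp (λ _ → refl) (λ _ → refl)
      (λ i → sym (val-φ x (adm x av) i)) (pres (val x) (adm x av))))
    (λ {x} {y} avx avy eq → lookup-injective λ i → Fin.toℕ-injective (ℤ.+-injective (begin
      val x i           ≡⟨ inv (val x) (adm x avx) i ⟨
      g (f (val x)) i   ≡⟨ g-cong _ _ (val-φ x (adm x avx)) i ⟨
      g (val (φ x)) i   ≡⟨ cong (λ z → g (val z) i) eq ⟩
      g (val (φ y)) i   ≡⟨ g-cong _ _ (val-φ y (adm y avy)) i ⟩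
      g (f (val y)) i   ≡⟨ inv (val y) (adm y avy) i ⟩
      val y i           ∎)))
    where
    open ≡-Reasoning
    adm : ∀ x → Avoids q (psiArr E a b) (val x) → Admissible q E a b (val x)
    adm = avoids⇒admissible 0∈
    φ : Vec (Fin q) ℓ → Vec (Fin q) ℓ
    φ x = Vec.tabulate (residue q ∘ f (val x))
    val-φ : ∀ x → Admissible q E a b (val x) → ∀ i → val (φ x) i ≡ f (val x) i
    val-φ x adm i = trans (cong (λ k → + toℕ k) (Vec.lookup∘tabulate (residue q ∘ f (val x)) i))
      (residue-small q (f (val x) i) (ℤ.<⇒≤ (admissible-pos 0∈′ (pres (val x) adm) i))
        (admissible-< 0∈′ (pres (val x) adm) i))

avoiding-bijection : ∀ {ℓ q} .{{_ : ℕ.NonZero q}} {E E′ : Digraph ℓ} {a b a′ b′} →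
  ContainsZero a b → ContainsZero a′ b′ → (f g : (Fin ℓ → ℤ) → Fin ℓ → ℤ) →
  (∀ x y → (∀ i → x i ≡ y i) → ∀ i → f x i ≡ f y i) →
  (∀ x y → (∀ i → x i ≡ y i) → ∀ i → g x i ≡ g y i) →
  (∀ x → Admissible q E a b x → Admissible q E′ a′ b′ (f x) × (∀ i → g (f x) i ≡ x i)) →
  (∀ y → Admissible q E′ a′ b′ y → Admissible q E a b (g y) × (∀ i → f (g y) i ≡ y i)) →
  avoiding q E a b ≡ avoiding q E′ a′ b′
avoiding-bijection {q = q} {E} {E′} 0∈ 0∈′ f g f-cong g-cong F G = ℕ.≤-antisym
  (avoiding-≤ {q = q} {E} {E′} 0∈ 0∈′ f g (λ x → proj₁ ∘ F x) (λ x → proj₂ ∘ F x) g-cong)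
  (avoiding-≤ {q = q} {E′} {E} 0∈′ 0∈ g f (λ y → proj₁ ∘ G y) (λ y → proj₂ ∘ G y) f-cong)

-- Coking and king elimination

-- `down t` closes the place t + 1, which it would identify with t; `up t` reopens it and never
-- takes the value t + 1.
down up : ℤ → ℤ → ℤ
down t z = if does (z ≤? t) then z else z - + 1
up   t z = if does (z ≤? t) then z else z + + 1

data Side (s : ℤ → ℤ → ℤ) (e t z : ℤ) : Set where
  low  : z ≤ t → s t z ≡ z → Side s e t z
  high : t < z → s t z ≡ z + e → Side s e t z

down-low : ∀ {t z} → z ≤ t → down t z ≡ z
down-low {t} {z} z≤t = cong (λ b → if b then z else z - + 1) (dec-true (z ≤? t) z≤t)

down-high : ∀ {t z} → t < z → down t z ≡ z - + 1
down-high {t} {z} t<z = cong (λ b → if b then z else z - + 1) (dec-false (z ≤? t) (ℤ.<⇒≱ t<z))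

up-low : ∀ {t z} → z ≤ t → up t z ≡ z
up-low {t} {z} z≤t = cong (λ b → if b then z else z + + 1) (dec-true (z ≤? t) z≤t)

up-high : ∀ {t z} → t < z → up t z ≡ z + + 1
up-high {t} {z} t<z = cong (λ b → if b then z else z + + 1) (dec-false (z ≤? t) (ℤ.<⇒≱ t<z))

down-side : ∀ t z → Side down (- + 1) t z
down-side t z = Sum.[ (λ z≤t → low z≤t (down-low z≤t)) , (λ z≰t → high (ℤ.≰⇒> z≰t) (down-high (ℤ.≰⇒> z≰t))) ]′
  (toSum (z ≤? t))

up-side : ∀ t z → Side up (+ 1) t z
up-side t z = Sum.[ (λ z≤t → low z≤t (up-low z≤t)) , (λ z≰t → high (ℤ.≰⇒> z≰t) (up-high (ℤ.≰⇒> z≰t))) ]′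
  (toSum (z ≤? t))

z-1+1 : ∀ z → (z - + 1) + + 1 ≡ z
z-1+1 = solve-∀

z+1-1 : ∀ z → (z + + 1) - + 1 ≡ z
z+1-1 = solve-∀

+1-injective : ∀ {u w} → u + + 1 ≡ w + + 1 → u ≡ w
+1-injective {u} {w} eq = trans (sym (z+1-1 u)) (trans (cong (λ z → z - + 1) eq) (z+1-1 w))

z<z+1 : ∀ {z} → z < z + + 1
z<z+1 = suc-≤ ℤ.≤-refl

down-up : ∀ t z → down t (up t z) ≡ z
down-up t z with up-side t z
... | low z≤t eq  = trans (cong (down t) eq) (down-low z≤t)
... | high t<z eq = trans (cong (down t) eq) (trans (down-high (ℤ.<-trans t<z z<z+1)) (z+1-1 z))

up-down : ∀ t z → ¬ z ≡ t + + 1 → up t (down t z) ≡ z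
up-down t z z≢ with down-side t z
... | low z≤t eq  = trans (cong (up t) eq) (up-low z≤t)
... | high t<z eq = trans (cong (up t) eq) (trans (up-high t<z-1) (z-1+1 z))
  where
  lem : ∀ z t → z - (t + + 1) ≡ (z - + 1) - t
  lem = solve-∀
  t<z-1 : t < z - + 1
  t<z-1 = <-shift (ℤ.≤∧≢⇒< (≤-suc t<z) (z≢ ∘ sym)) (lem z t)

module _ {ℓ} (v : Fin ℓ) where

  slide-down slide-up : (Fin ℓ → ℤ) → Fin ℓ → ℤ
  slide-down x i = down (x v) (x i)
  slide-up   x i = up (x v) (x i)

  slide-down-v : ∀ x → slide-down x v ≡ x v
  slide-down-v x = down-low ℤ.≤-refl

  slide-up-v : ∀ x → slide-up x v ≡ x v
  slide-up-v x = up-low ℤ.≤-refl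

  slide-down-up : ∀ y i → slide-down (slide-up y) i ≡ y i
  slide-down-up y i = trans (cong (λ t → down t (slide-up y i)) (slide-up-v y)) (down-up (y v) (y i))

  cokingA-v : ∀ a → cokingA a v v ≡ a v
  cokingA-v a = cong (λ b → if b then a v else a v - + 1) (dec-true (v Fin.≟ v) refl)

  cokingA-≢ : ∀ a {i} → ¬ i ≡ v → cokingA a v i ≡ a i - + 1
  cokingA-≢ a {i} i≢v = cong (λ b → if b then a i else a i - + 1) (dec-false (i Fin.≟ v) i≢v)

  cokingE⁻ : ∀ (E : Digraph ℓ) i j → cokingE E v i j ≡ true → (E i j ≡ true) × (¬ j ≡ v)
  cokingE⁻ E i j e with E i j | j Fin.≟ v
  ... | true | no j≢v = refl , j≢v

  cokingE⁺ : ∀ (E : Digraph ℓ) i j → E i j ≡ true → ¬ j ≡ v → cokingE E v i j ≡ true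
  cokingE⁺ E i j e j≢v = cong₂ _∧_ e (cong not (dec-false (j Fin.≟ v) j≢v))

-- `aᵥ≤` secures the tightened upper bound for coordinates that stay in place, `bᵥ≥` the unchanged
-- lower bound for those that are lowered.
module Coking {ℓ} (q : ℕ) (E : Digraph ℓ) (a b : Fin ℓ → ℤ) (v : Fin ℓ) (coking : IsCoking E v)
  (aᵥ≤ : ∀ i → ¬ i ≡ v → a v ≤ a i) (bᵥ≥ : ∀ i → ¬ i ≡ v → b i - + 1 ≤ b v) where

  E′ : Digraph ℓ
  E′ = cokingE E v

  a′ : Fin ℓ → ℤ
  a′ = cokingA a v

  slide-up-down : ∀ {x} → Admissible q E a b x → ∀ i → slide-up v (slide-down v x) i ≡ x i
  slide-up-down {x} adm i = trans (cong (λ t → up t (slide-down v x i)) (slide-down-v v x))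
    (up-down (x v) (x i) not-next)
    where
    not-next : ¬ x i ≡ x v + + 1
    not-next eq with i Fin.≟ v
    ... | no i≢v   = edge adm i v (coking i i≢v) eq
    ... | yes refl = ℤ.<-irrefl eq z<z+1

  slide-down-admissible : ∀ {x} → Admissible q E a b x → Admissible q E′ a′ b (slide-down v x)
  slide-down-admissible {x} adm = record { distinct = dist ; edge = edg ; lower = low′ ; upper = upp }
    where
    y : Fin ℓ → ℤ
    y = slide-down v x
    dist : ∀ i j → ¬ i ≡ j → ¬ y i ≡ y j
    dist i j i≢j eq = distinct adm i j i≢j
      (trans (sym (slide-up-down adm i)) (trans (cong (up (y v)) eq) (slide-up-down adm j)))
    -- The edge from `i` to the coking forbids x v + 1, so a coordinate above x v exceeds it by at
    -- least 2.
    beyond : ∀ i → x v < x i → x v + + 1 < x i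
    beyond i xv<xi = ℤ.≤∧≢⇒< (≤-suc xv<xi)
      λ eq → edge adm i v (coking i λ { refl → ℤ.<-irrefl refl xv<xi }) (sym eq)
    edg : ∀ i j → E′ i j ≡ true → ¬ y i ≡ y j + + 1
    edg i j e′ eq with cokingE⁻ v E i j e′ | down-side (x v) (x i) | down-side (x v) (x j)
    ... | e , _ | low _ yi | low _ yj = edge adm i j e (trans (sym yi) (trans eq (cong (_+ + 1) yj)))
    ... | e , _ | high _ yi | high _ yj = edge adm i j e (trans (sym (z-1+1 (x i)))
      (cong (_+ + 1) (trans (sym yi) (trans eq (trans (cong (_+ + 1) yj) (z-1+1 (x j)))))))
    ... | _ , _ | low xi≤ yi | high xv< yj = ℤ.<-irrefl
      (trans (sym yi) (trans eq (trans (cong (_+ + 1) yj) (z-1+1 (x j))))) (ℤ.≤-<-trans xi≤ xv<)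
    -- Here x j < x v, as j ≠ v, while y i = x i - 1 is at least x v + 1. For j = v the equation y i
    -- = y v + 1 can occur, namely when x i = x v + 2; this is why the edges into v must be removed.
    ... | _ , j≢v | high xv< yi | low xj≤ yj = ℤ.<-irrefl
      (trans (sym yj) (trans (sym (z+1-1 (y j))) (cong (λ z → z - + 1) (trans (sym eq) yi))))
      (ℤ.<-≤-trans (ℤ.≤∧≢⇒< xj≤ (distinct adm j v j≢v)) (≤-shift (≤-suc (beyond i xv<)) (lem (x i) (x v))))
      where
      lem : ∀ x t → x - ((t + + 1) + + 1) ≡ ((x - + 1) - + 1) - t
      lem = solve-∀
    low′ : ∀ i → b i < y i
    low′ i with down-side (x v) (x i)
    ... | low _ yi    = subst (b i <_) (sym yi) (lower adm i)
    -- From b i - 1 ≤ b v < x v follows b i ≤ x v, and x i - 1 still exceeds x v.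
    ... | high xv< yi = subst (b i <_) (sym yi) (<-shift
      (ℤ.+-mono-≤-< (≤-suc (ℤ.≤-<-trans (bᵥ≥ i i≢v) (lower adm v))) (beyond i xv<)) (lem (x i) (x v) (b i)))
      where
      i≢v : ¬ i ≡ v
      i≢v refl = ℤ.<-irrefl refl xv<
      lem : ∀ x t b → (t + x) - (((b - + 1) + + 1) + (t + + 1)) ≡ (x + - + 1) - b
      lem = solve-∀
    upp : ∀ i → y i < + q + a′ i
    upp i with i Fin.≟ v
    ... | yes refl = subst (_< + q + a v) (sym (slide-down-v v x)) (upper adm v)
    ... | no i≢v with down-side (x v) (x i)
    ...   | high _ yi = subst (_< + q + (a i - + 1)) (sym yi) (<-shift (upper adm i) (lem (+ q) (a i) (x i)))
      where
      lem : ∀ q a x → (q + a) - x ≡ (q + (a - + 1)) - (x + - + 1)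
      lem = solve-∀
    -- The coordinate does not move although its bound drops by 1: it has room because x i + 1 ≤ x v
    -- < q + a v ≤ q + a i.
    ...   | low xi≤ yi = subst (_< + q + (a i - + 1)) (sym yi)
      (<-shift (ℤ.≤-<-trans (≤-suc (ℤ.≤∧≢⇒< xi≤ (distinct adm i v i≢v)))
        (ℤ.<-≤-trans (upper adm v) (ℤ.+-monoʳ-≤ (+ q) (aᵥ≤ i i≢v)))) (lem (+ q) (a i) (x i)))
      where
      lem : ∀ q a x → (q + a) - (x + + 1) ≡ (q + (a - + 1)) - x
      lem = solve-∀

  slide-up-admissible : ∀ {y} → Admissible q E′ a′ b y → Admissible q E a b (slide-up v y)
  slide-up-admissible {y} adm = record { distinct = dist ; edge = edg ; lower = low′ ; upper = upp }
    where
    x : Fin ℓ → ℤ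
    x = slide-up v y
    dist : ∀ i j → ¬ i ≡ j → ¬ x i ≡ x j
    dist i j i≢j eq = distinct adm i j i≢j
      (trans (sym (slide-down-up v y i)) (trans (cong (down (x v)) eq) (slide-down-up v y j)))
    edg : ∀ i j → E i j ≡ true → ¬ x i ≡ x j + + 1
    edg i j e eq with j Fin.≟ v
    -- The edges into v, absent from `E′`, are respected because `up (y v)` omits the value y v + 1.
    edg i j e eq | yes refl with up-side (y v) (y i)
    ... | low yi≤ xi  = ℤ.<-irrefl (trans (sym xi) (trans eq (cong (_+ + 1) (slide-up-v v y))))
      (ℤ.≤-<-trans yi≤ z<z+1)
    ... | high yv< xi = ℤ.<-irrefl (sym (+1-injective
      (trans (sym xi) (trans eq (cong (_+ + 1) (slide-up-v v y)))))) yv<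
    edg i j e eq | no j≢v with up-side (y v) (y i) | up-side (y v) (y j)
    ... | low _ xi | low _ xj = edge adm i j (cokingE⁺ v E i j e j≢v)
      (trans (sym xi) (trans eq (cong (_+ + 1) xj)))
    ... | high _ xi | high _ xj = edge adm i j (cokingE⁺ v E i j e j≢v)
      (+1-injective (trans (sym xi) (trans eq (cong (_+ + 1) xj))))
    ... | low yi≤ xi | high yv< xj = ℤ.<-irrefl (trans (sym xi) (trans eq (cong (_+ + 1) xj)))
      (ℤ.≤-<-trans yi≤ (ℤ.<-trans yv< (ℤ.<-trans z<z+1 z<z+1)))
    ... | high yv< xi | low yj≤ xj = ℤ.<-irrefl (sym (+1-injective
      (trans (sym xi) (trans eq (cong (_+ + 1) xj))))) (ℤ.≤-<-trans yj≤ yv<)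
    low′ : ∀ i → b i < x i
    low′ i with up-side (y v) (y i)
    ... | low _ xi  = subst (b i <_) (sym xi) (lower adm i)
    ... | high _ xi = subst (b i <_) (sym xi) (ℤ.<-trans (lower adm i) z<z+1)
    upp : ∀ i → x i < + q + a i
    upp i = Sum.[ at-v , (λ i≢v → off-v i i≢v) ]′ (toSum (i Fin.≟ v))
      where
      at-v : ∀ {i} → i ≡ v → x i < + q + a i
      at-v refl = subst₂ (λ x a → x < + q + a) (sym (slide-up-v v y)) (cokingA-v v a) (upper adm v)
      off-v : ∀ i → ¬ i ≡ v → x i < + q + a i
      off-v i i≢v with up-side (y v) (y i)
      ... | high _ xi = subst (_< + q + a i) (sym xi) bound
        where
        lem : ∀ q a y → (q + (a - + 1)) - y ≡ (q + a) - (y + + 1)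
        lem = solve-∀
        bound : y i + + 1 < + q + a i
        bound = <-shift (subst (λ z → y i < + q + z) (cokingA-≢ v a i≢v) (upper adm i)) (lem (+ q) (a i) (y i))
      ... | low _ xi = subst (_< + q + a i) (sym xi) (ℤ.<-trans bound (ℤ.+-monoʳ-< (+ q) a-1<a))
        where
        bound : y i < + q + (a i - + 1)
        bound = subst (λ z → y i < + q + z) (cokingA-≢ v a i≢v) (upper adm i)
        a-1<a : a i - + 1 < a i
        a-1<a = suc-≤ (ℤ.≤-reflexive (z-1+1 (a i)))

cokingA-≤ : ∀ {ℓ} (a : Fin ℓ → ℤ) v i → cokingA a v i ≤ a i
cokingA-≤ a v i with i Fin.≟ v
... | yes _ = ℤ.≤-refl
... | no _  = ℤ.i-j≤i (a i) (+ 1)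

CokingCondition : ∀ {ℓ} → (a b : Fin ℓ → ℤ) → Fin ℓ → Set
CokingCondition a b v = ∀ i → ¬ i ≡ v → ∀ c → a i ≤ c → c ≤ b i - + 1 → (a v ≤ c) × (c ≤ b v)

cokingCondition⇒bounds : ∀ {ℓ} {a b : Fin ℓ → ℤ} {v} → ContainsZero a b → CokingCondition a b v →
  ∀ i → ¬ i ≡ v → (a v ≤ a i) × (b i - + 1 ≤ b v)
cokingCondition⇒bounds {a = a} {b} {v} 0∈ H i i≢v with a i ≤? b i - + 1
... | yes a≤b-1 = proj₁ (H i i≢v (a i) ℤ.≤-refl a≤b-1) , proj₂ (H i i≢v (b i - + 1) a≤b-1 ℤ.≤-refl)
-- The interval [a i, b i - 1] is empty, so the condition says nothing; but then b i ≤ a i, and both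
-- bounds follow by comparing with 0, which lies in ψ(i) and ψ(v).
... | no a≰b-1 = ℤ.≤-trans (proj₁ (0∈ v)) (ℤ.≤-trans (proj₂ (0∈ i)) b≤a)
               , ℤ.≤-trans (ℤ.<⇒≤ b-1<a) (ℤ.≤-trans (proj₁ (0∈ i)) (proj₂ (0∈ v)))
  where
  b-1<a : b i - + 1 < a i
  b-1<a = ℤ.≰⇒> a≰b-1
  b≤a : b i ≤ a i
  b≤a = subst (_≤ a i) (z-1+1 (b i)) (≤-suc b-1<a)

avoiding-coking : ∀ {ℓ} q .{{_ : ℕ.NonZero q}} (E : Digraph ℓ) a b v → IsCoking E v →
  ContainsZero a b → CokingCondition a b v → avoiding q E a b ≡ avoiding q (cokingE E v) (cokingA a v) b
avoiding-coking q E a b v coking 0∈ H = avoiding-bijection 0∈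
  (λ i → ℤ.≤-trans (cokingA-≤ a v i) (proj₁ (0∈ i)) , proj₂ (0∈ i))
  (slide-down v) (slide-up v)
  (λ x y eq i → cong₂ down (eq v) (eq i)) (λ x y eq i → cong₂ up (eq v) (eq i))
  (λ x adm → slide-down-admissible adm , slide-up-down adm)
  (λ y adm → slide-up-admissible adm , slide-down-up v y)
  where
  open Coking q E a b v coking
    (λ i → proj₁ ∘ cokingCondition⇒bounds 0∈ H i) (λ i → proj₂ ∘ cokingCondition⇒bounds 0∈ H i)

-- Reflection and king elimination

reflect : ∀ {ℓ} → ℕ → (Fin ℓ → ℤ) → Fin ℓ → ℤ
reflect q x i = + q - x i

reflect-reflect : ∀ {ℓ} q (x : Fin ℓ → ℤ) i → reflect q (reflect q x) i ≡ x i
reflect-reflect q x i = lem (+ q) (x i)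
  where
  lem : ∀ q x → q - (q - x) ≡ x
  lem = solve-∀

-- The equation x i = x j + 1 becomes q - x j = (q - x i) + 1, so edges turn round, while the lower
-- and the upper bounds change places with a sign.
reflect-admissible : ∀ {ℓ q} {E : Digraph ℓ} {a b x} → Admissible q E a b x →
  Admissible q (flip E) (-_ ∘ b) (-_ ∘ a) (reflect q x)
reflect-admissible {q = q} {a = a} {b} {x} adm = record
  { distinct = λ i j i≢j eq → distinct adm i j i≢j (trans (sym (reflect-reflect q x i))
      (trans (cong (λ z → + q - z) eq) (reflect-reflect q x j)))
  ; edge     = λ i j e eq → edge adm j i e (trans (lem₁ (+ q) (x j))
      (trans (cong (λ z → + q - z + + 1) (sym eq)) (lem₂ (+ q) (x i))))
  ; lower    = λ i → <-shift (upper adm i) (lem₃ (+ q) (a i) (x i))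
  ; upper    = λ i → <-shift (lower adm i) (lem₄ (+ q) (b i) (x i)) }
  where
  lem₁ : ∀ q x → x ≡ q - ((q - x) + + 1) + + 1
  lem₁ = solve-∀
  lem₂ : ∀ q x → q - (q - x) + + 1 ≡ x + + 1
  lem₂ = solve-∀
  lem₃ : ∀ q a x → (q + a) - x ≡ (q - x) - - a
  lem₃ = solve-∀
  lem₄ : ∀ q b x → x - b ≡ (q + - b) - (q - x)
  lem₄ = solve-∀

ContainsZero-neg : ∀ {ℓ} {a b : Fin ℓ → ℤ} → ContainsZero a b → ContainsZero (-_ ∘ b) (-_ ∘ a)
ContainsZero-neg 0∈ i = ℤ.neg-mono-≤ (proj₂ (0∈ i)) , ℤ.neg-mono-≤ (proj₁ (0∈ i))

avoiding-reflect : ∀ {ℓ} q .{{_ : ℕ.NonZero q}} (E : Digraph ℓ) a b → ContainsZero a b →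
  avoiding q E a b ≡ avoiding q (flip E) (-_ ∘ b) (-_ ∘ a)
avoiding-reflect q E a b 0∈ = avoiding-bijection 0∈ (ContainsZero-neg 0∈) (reflect q) (reflect q)
  (λ x y eq i → cong (λ z → + q - z) (eq i)) (λ x y eq i → cong (λ z → + q - z) (eq i))
  (λ x adm → reflect-admissible adm , reflect-reflect q x)
  (λ y adm → Admissible-resp (ℤ.neg-involutive ∘ a) (ℤ.neg-involutive ∘ b) (λ _ → refl) (reflect-admissible adm)
           , reflect-reflect q y)

neg-kingB : ∀ {ℓ} (b : Fin ℓ → ℤ) v i → - kingB b v i ≡ cokingA (-_ ∘ b) v i
neg-kingB b v i with i Fin.≟ v
... | yes _ = refl
... | no _  = ℤ.neg-distrib-+ (b i) (+ 1)

kingB-≥ : ∀ {ℓ} (b : Fin ℓ → ℤ) v i → b i ≤ kingB b v i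
kingB-≥ b v i with i Fin.≟ v
... | yes _ = ℤ.≤-refl
... | no _  = ℤ.i≤i+j (b i) (+ 1)

-- Needed because the negated `kingB` and the `cokingA` of the reflected intervals agree only
-- pointwise.
avoiding-resp : ∀ {ℓ} q .{{_ : ℕ.NonZero q}} (E : Digraph ℓ) {a a′ b} → ContainsZero a b →
  (∀ i → a i ≡ a′ i) → avoiding q E a b ≡ avoiding q E a′ b
avoiding-resp q E 0∈ a≡ = avoiding-bijection 0∈ (λ i → subst (_≤ + 0) (a≡ i) (proj₁ (0∈ i)) , proj₂ (0∈ i))
  (λ x → x) (λ x → x) (λ _ _ eq → eq) (λ _ _ eq → eq)
  (λ x adm → Admissible-resp a≡ (λ _ → refl) (λ _ → refl) adm , λ _ → refl)
  (λ x adm → Admissible-resp (sym ∘ a≡) (λ _ → refl) (λ _ → refl) adm , λ _ → refl)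

avoiding-king : ∀ {ℓ} q .{{_ : ℕ.NonZero q}} (E : Digraph ℓ) a b v → IsKing E v →
  ContainsZero a b → CokingCondition (-_ ∘ b) (-_ ∘ a) v →
  avoiding q E a b ≡ avoiding q (kingE E v) a (kingB b v)
avoiding-king q E a b v king 0∈ H = begin
  avoiding q E a b
    ≡⟨ avoiding-reflect q E a b 0∈ ⟩
  avoiding q (flip E) (-_ ∘ b) (-_ ∘ a)
    ≡⟨ avoiding-coking q (flip E) (-_ ∘ b) (-_ ∘ a) v king (ContainsZero-neg 0∈) H ⟩
  -- Removing the edges out of v and then reversing is, by definition, reversing and then removing
  -- the edges into v; likewise a king of `E` is by definition a coking of `flip E`.
  avoiding q (flip (kingE E v)) (cokingA (-_ ∘ b) v) (-_ ∘ a)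
    ≡⟨ avoiding-resp q (flip (kingE E v)) (ContainsZero-neg 0∈″) (neg-kingB b v) ⟨
  avoiding q (flip (kingE E v)) (-_ ∘ kingB b v) (-_ ∘ a)
    ≡⟨ avoiding-reflect q (kingE E v) a (kingB b v) 0∈″ ⟨
  avoiding q (kingE E v) a (kingB b v) ∎
  where
  open ≡-Reasoning
  0∈″ : ContainsZero a (kingB b v)
  0∈″ i = proj₁ (0∈ i) , ℤ.≤-trans (proj₂ (0∈ i)) (kingB-≥ b v i)

psiArr-proper : ∀ {ℓ} {E : Digraph ℓ} {a b : Fin ℓ → ℤ} → (∀ i → a i ≤ b i) → (∀ i → E i i ≡ false) →
  All Proper (psiArr E a b)
psiArr-proper a≤b loopless = psiArr⁺ a≤b
  (λ { i j i<j refl → ℕ.<-irrefl refl i<j })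
  (λ { i j e refl → contradiction (trans (sym e) (loopless i)) λ () })
  (λ _ _ _ _ ())

theorem3p1 : ∀ {ℓ : ℕ} (E : Digraph ℓ) (a b : Fin ℓ → ℤ) (v : Fin ℓ)
    → (∀ i → E i i ≡ false)
    → (∀ i → a i ≤ b i)
    → (IsCoking E v
    → (∀ i → (a i ≤ + 0) × (+ 0 ≤ b i))
    → (∀ i → ¬ (i ≡ v) → ∀ c → a i ≤ c → c ≤ b i - + 1 → (a v ≤ c) × (c ≤ b v))
    → Σ (ℕ → ℤ) (λ p → IsCharPoly (psiArr E a b) p
    × IsCharPoly (psiArr (cokingE E v) (cokingA a v) b) p))
    × (IsKing E v
    → (∀ i → (a i ≤ + 0) × (+ 0 ≤ b i))
    → (∀ i → ¬ (i ≡ v) → ∀ c → a i + + 1 ≤ c → c ≤ b i → (a v ≤ c) × (c ≤ b v))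
    → Σ (ℕ → ℤ) (λ p → IsCharPoly (psiArr E a b) p
    × IsCharPoly (psiArr (kingE E v) a (kingB b v)) p))
theorem3p1 E a b v loopless a≤b =
  (λ coking 0∈ H → common-charPoly (psiArr E a b) (psiArr (cokingE E v) (cokingA a v) b)
    (psiArr-proper a≤b loopless)
    (psiArr-proper (λ i → ℤ.≤-trans (cokingA-≤ a v i) (a≤b i)) (λ i → cong (_∧ not (i ≟ᵇ v)) (loopless i)))
    (λ q → avoiding-coking q E a b v coking 0∈ H)) ,
  (λ king 0∈ H → common-charPoly (psiArr E a b) (psiArr (kingE E v) a (kingB b v))
    (psiArr-proper a≤b loopless)
    (psiArr-proper (λ i → ℤ.≤-trans (a≤b i) (kingB-≥ b v i)) (λ i → cong (_∧ not (i ≟ᵇ v)) (loopless i)))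
    (λ q → avoiding-king q E a b v king 0∈ (negated H)))
  where
  negated : (∀ i → ¬ (i ≡ v) → ∀ c → a i + + 1 ≤ c → c ≤ b i → (a v ≤ c) × (c ≤ b v)) →
    CokingCondition (-_ ∘ b) (-_ ∘ a) v
  -- Negation carries [- b i, - a i - 1] to [a i + 1, b i], so the condition is used at - c.
  negated H i i≢v c -b≤c c≤-a-1 =
    let (aᵥ≤-c , -c≤bᵥ) = H i i≢v (- c) (≤-shift c≤-a-1 (lem₁ (a i) c)) (≤-shift -b≤c (lem₂ (b i) c))
    in ≤-shift -c≤bᵥ (lem₃ (b v) c) , ≤-shift aᵥ≤-c (lem₄ (a v) c)
    where
    lem₁ : ∀ a c → (- a - + 1) - c ≡ - c - (a + + 1)
    lem₁ = solve-∀
    lem₂ : ∀ b c → c - - b ≡ b - - c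
    lem₂ = solve-∀
    lem₃ : ∀ b c → b - - c ≡ c - - b
    lem₃ = solve-∀
    lem₄ : ∀ a c → - c - a ≡ - a - c
    lem₄ = solve-∀
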